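{- Let $G$ be a $5$-regular graph that has no $\{4,1\}$-factor, and which is vertex-minimal with this property (every $5$-regular graph with fewer vertices than $G$ has a $\{4,1\}$-factor). Then: (a) $G$ does not contain a copy of $K_4$. (b) $G$ has no parallel non-loop edges. (c) No two vertices with loops are adjacent. (d) $G$ contains at least $5$ loops. (e) There do not exist vertices $u_1,u_2,u_3,v_1,v_2,v_3\in V(G)$ such that each $u_i$ has a loop and $u_i$ is adjacent to $v_j$ for all $i,j\in\{1,2,3\}$.
   Context: All graphs are finite, undirected pseudographs (multiple edges and loops allowed; a loop contributes $2$ to the degree). A $\{4,1\}$-factor of a graph is a spanning subgraph in which every vertex has degree $4$ or $1$. -}

module Defs where

open import Data.Nat using (ℕ; _≤_; _<_; _+_)
open import Data.Fin using (Fin)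
open import Data.List using (map; allFin)
open import Data.Nat.ListAction using (sum)
open import Data.Product using (Σ; _×_)
open import Data.Sum using (_⊎_)
open import Relation.Binary.PropositionalEquality using (_≡_; _≢_)
open import Function.Definitions using (Injective)

-- A finite pseudograph on vertex set Fin n, given by its (symmetric)
-- edge-multiplicity matrix.  adj i j (i ≢ j) = number of edges between i and j;
-- adj i i = number of loops at i.
record Graph : Set where
  field
    n   : ℕ
    adj : Fin n → Fin n → ℕ
    sym : ∀ i j → adj i j ≡ adj j i
open Graph public

Σ-fin : ∀ {n} → (Fin n → ℕ) → ℕ
Σ-fin {n} f = sum (map f (allFin n))

-- degree in a multiplicity matrix: each loop contributes 2
degreeOf : ∀ {n} → (Fin n → Fin n → ℕ) → Fin n → ℕ
degreeOf A i = Σ-fin (A i) + A i i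

degree : (G : Graph) → Fin (n G) → ℕ
degree G = degreeOf (adj G)

Regular : ℕ → Graph → Set
Regular k G = ∀ v → degree G v ≡ k

Adjacent : (G : Graph) → Fin (n G) → Fin (n G) → Set
Adjacent G u v = u ≢ v × 1 ≤ adj G u v

HasLoop : (G : Graph) → Fin (n G) → Set
HasLoop G v = 1 ≤ adj G v v

loopCount : Graph → ℕ
loopCount G = Σ-fin (λ v → adj G v v)

record Factor41 (G : Graph) : Set where
  field
    F     : Fin (n G) → Fin (n G) → ℕ
    F-sym : ∀ i j → F i j ≡ F j i
    F-sub : ∀ i j → F i j ≤ adj G i j
    F-deg : ∀ v → degreeOf F v ≡ 4 ⊎ degreeOf F v ≡ 1

ContainsK4 : Graph → Set
ContainsK4 G = Σ (Fin 4 → Fin (n G)) λ f →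
  Injective _≡_ _≡_ f × (∀ a b → a ≢ b → 1 ≤ adj G (f a) (f b))

{-# OPTIONS --safe #-}
module Submission where

-- A {4,1}-factor is a red/blue colouring of the edges in which every vertex has one edge of one
-- colour and four of the other.
--
-- (a), (b), (c), (e): delete the forbidden configuration and join up the dangling half-edges.  If u and
-- v have equally many half-edges, matching those of u with those of v makes every colouring of the
-- smaller graph extend so that u and v receive the same number of red half-edges; joining the two
-- half-edges of a single vertex gives it 0 or 2 red ones.  A finite check then colours the deleted edges.
--
-- (d): every odd vertex set D satisfies |∂D| + 2·loops(D) ≥ 5.  Otherwise |∂D| is 1 or 3; contracting D
-- to a vertex with loops gives a smaller graph, in whose factor (up to exchanging the colours) exactly
-- one edge of ∂D is red, say at x ∈ D.  A perfect matching of D − x would extend this to a factor of G,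
-- so Tutte's theorem gives a barrier in D − x, and counting the edges leaving its odd pieces, for
-- which the claim holds by induction, contradicts |∂D| + 2·loops(D) < 5.  As G has no perfect matching
-- either, it has a barrier, and the same count yields 5 loops.
--
-- Tutte's theorem is obtained, doubly negated, from Gallai's lemma: if every vertex is missed by some
-- maximum matching, "no maximum matching misses both" is an equivalence relation with odd classes.

open import Defs
open import Data.Nat
open import Data.Nat.Properties
open import Data.Nat.ListAction using (sum)
open import Data.Nat.Solver using (module +-*-Solver)
open import Data.Bool using (Bool; true; false; not; _∧_; _∨_; _xor_; if_then_else_)
import Data.Bool.Properties as Boolₚ
open import Data.Fin using (Fin; zero; suc; toℕ; splitAt; join)
open import Data.Fin.Patterns
import Data.Fin as Fin
import Data.Fin.Properties as Finₚ
open import Data.List using (List; []; _∷_; _++_; replicate)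
open import Data.List.Properties using (map-tabulate)
open import Data.List.Relation.Unary.All using (All; []; _∷_)
import Data.List.Relation.Unary.All as All
open import Data.Product using (Σ; ∃; _×_; _,_; proj₁; proj₂)
open import Data.Sum using (_⊎_; inj₁; inj₂; [_,_]′)
open import Data.Empty using (⊥; ⊥-elim)
open import Relation.Binary.PropositionalEquality renaming (sym to ≡-sym)
open import Relation.Nullary using (¬_; Dec; yes; no; does; contradiction)
open import Relation.Nullary.Decidable using (from-yes; _⊎-dec_; _×-dec_; ¬?; dec-true; dec-false; toSum; True; toWitness; ¬¬-excluded-middle)
open import Function using (_∘_; id)
open import Function.Definitions using (Injective)
open import Algebra.Properties.CommutativeSemigroup +-commutativeSemigroup using (interchange; x∙yz≈y∙xz)
open +-*-Solver using (solve; con; _:+_; _:*_; _:=_)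

-- For a single vertex |∂D| + 2·loops(D) is its degree 5, so the claim on odd sets says that none is
-- cheaper than a vertex. This is the origin of the 5 loops: by parity a barrier with s Tutte
-- vertices has at least s + 2 odd pieces, which demand 5(s + 2). The edges at the Tutte set supply
-- at most 5s, and the missing 10 must come from loops at two apiece. In D - x the vertex x acts as
-- one more Tutte vertex, so at least 5 is left to be paid by ∂D and the loops of D.
--
-- The graph is turned from a multiplicity matrix into an edge list, because deleting edges, joining
-- half-edges and colouring single edges are direct on lists; a loop is a pair (v , v) and has two
-- incidences without a special case.
--
-- The existence of a maximum matching, and for each pair the alternative whether some maximum
-- matching misses both vertices, are assumed under a double negation. This costs nothing, since the
-- conclusions drawn are either absurd or decidable inequalities.

bit : Bool → ℕ
bit true  = 1
bit false = 0

δ : ∀ {n} → Fin n → Fin n → ℕ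
δ a b = bit (does (a Fin.≟ b))

δ-refl : ∀ {n} (a : Fin n) → δ a a ≡ 1
δ-refl zero    = refl
δ-refl (suc a) = δ-refl a

δ-≢ : ∀ {n} {a b : Fin n} → a ≢ b → δ a b ≡ 0
δ-≢ {a = a} {b} a≢b with a Fin.≟ b
... | yes a≡b = contradiction a≡b a≢b
... | no  _   = refl

δ-comm : ∀ {n} (a b : Fin n) → δ a b ≡ δ b a
δ-comm zero    zero    = refl
δ-comm zero    (suc b) = refl
δ-comm (suc a) zero    = refl
δ-comm (suc a) (suc b) = δ-comm a b

δ-inj : ∀ {m n} {f : Fin m → Fin n} → Injective _≡_ _≡_ f → ∀ a b → δ (f a) (f b) ≡ δ a b
δ-inj {f = f} inj a b with a Fin.≟ b
... | yes refl = δ-refl (f a)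
... | no a≢b   = δ-≢ (a≢b ∘ inj)

-- Sums over `Fin n`

Σ-suc : ∀ {n} (f : Fin (suc n) → ℕ) → Σ-fin f ≡ f zero + Σ-fin (f ∘ suc)
Σ-suc f = cong (λ l → f zero + sum l) (trans (map-tabulate suc f) (≡-sym (map-tabulate id (f ∘ suc))))

Σ-cong : ∀ {n} {f g : Fin n → ℕ} → (∀ i → f i ≡ g i) → Σ-fin f ≡ Σ-fin g
Σ-cong {zero}          h = refl
Σ-cong {suc n} {f} {g} h = trans (Σ-suc f) (trans (cong₂ _+_ (h zero) (Σ-cong (h ∘ suc))) (≡-sym (Σ-suc g)))

Σ-mono : ∀ {n} {f g : Fin n → ℕ} → (∀ i → f i ≤ g i) → Σ-fin f ≤ Σ-fin g
Σ-mono {zero}          h = z≤n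
Σ-mono {suc n} {f} {g} h rewrite Σ-suc f | Σ-suc g = +-mono-≤ (h zero) (Σ-mono (h ∘ suc))

Σ-0 : ∀ n → Σ-fin {n} (λ _ → 0) ≡ 0
Σ-0 zero    = refl
Σ-0 (suc n) = trans (Σ-suc {n} (λ _ → 0)) (Σ-0 n)

Σ-+ : ∀ {n} (f g : Fin n → ℕ) → Σ-fin (λ i → f i + g i) ≡ Σ-fin f + Σ-fin g
Σ-+ {zero}  f g = refl
Σ-+ {suc n} f g rewrite Σ-suc (λ i → f i + g i) | Σ-suc f | Σ-suc g | Σ-+ (f ∘ suc) (g ∘ suc) =
  interchange (f zero) (g zero) _ _

Σ-*ˡ : ∀ {n} c (f : Fin n → ℕ) → Σ-fin (λ i → c * f i) ≡ c * Σ-fin f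
Σ-*ˡ {zero}  c f = ≡-sym (*-zeroʳ c)
Σ-*ˡ {suc n} c f rewrite Σ-suc (λ i → c * f i) | Σ-suc f | Σ-*ˡ c (f ∘ suc) =
  ≡-sym (*-distribˡ-+ c (f zero) _)

Σ-δ : ∀ {n} (a : Fin n) (f : Fin n → ℕ) → Σ-fin (λ i → δ a i * f i) ≡ f a
Σ-δ {suc n} zero f = trans (Σ-suc (λ i → δ zero i * f i))
  (trans (cong₂ _+_ (+-identityʳ (f zero)) (Σ-0 n)) (+-identityʳ (f zero)))
Σ-δ {suc n} (suc a) f = trans (Σ-suc (λ i → δ (suc a) i * f i)) (Σ-δ a (f ∘ suc))

Σ-δ₁ : ∀ {n} (a : Fin n) → Σ-fin (δ a) ≡ 1
Σ-δ₁ a = trans (Σ-cong (λ i → ≡-sym (*-identityʳ (δ a i)))) (Σ-δ a (λ _ → 1))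

term≤Σ : ∀ {n} (f : Fin n → ℕ) a → f a ≤ Σ-fin f
term≤Σ f a = subst (_≤ Σ-fin f) (Σ-δ a f) (Σ-mono le)
  where
  le : ∀ i → δ a i * f i ≤ f i
  le i with does (a Fin.≟ i)
  ... | true  = ≤-reflexive (+-identityʳ (f i))
  ... | false = z≤n

count : ∀ {n} → (Fin n → Bool) → ℕ
count P = Σ-fin (bit ∘ P)

-- Edge lists

Edge : ℕ → Set
Edge n = Fin n × Fin n

-- Degrees, multiplicities, sizes, cut values and loop counts are all instances of this sum, so
-- rearrangement, splitting and double counting are proved once for all of them.
W : ∀ {n} → (Edge n → ℕ) → List (Edge n) → ℕ
W f []      = 0
W f (e ∷ E) = f e + W f E

W-++ : ∀ {n} f (E E′ : List (Edge n)) → W f (E ++ E′) ≡ W f E + W f E′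
W-++ f []      E′ = refl
W-++ f (e ∷ E) E′ = trans (cong (f e +_) (W-++ f E E′)) (≡-sym (+-assoc (f e) _ _))

W-cong : ∀ {n} {f g : Edge n → ℕ} (E : List (Edge n)) → (∀ e → f e ≡ g e) → W f E ≡ W g E
W-cong []      h = refl
W-cong (e ∷ E) h = cong₂ _+_ (h e) (W-cong E h)

W-congᴬ : ∀ {n} {f g : Edge n → ℕ} {E : List (Edge n)} → All (λ e → f e ≡ g e) E → W f E ≡ W g E
W-congᴬ []       = refl
W-congᴬ (p ∷ ps) = cong₂ _+_ p (W-congᴬ ps)

W-monoᴬ : ∀ {n} {f g : Edge n → ℕ} {E : List (Edge n)} → All (λ e → f e ≤ g e) E → W f E ≤ W g E
W-monoᴬ []       = z≤n
W-monoᴬ (p ∷ ps) = +-mono-≤ p (W-monoᴬ ps)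

W-mono : ∀ {n} {f g : Edge n → ℕ} (E : List (Edge n)) → (∀ e → f e ≤ g e) → W f E ≤ W g E
W-mono E h = W-monoᴬ (All.universal h E)

W-+ : ∀ {n} (f g : Edge n → ℕ) (E : List (Edge n)) → W (λ e → f e + g e) E ≡ W f E + W g E
W-+ f g []      = refl
W-+ f g (e ∷ E) = trans (cong (f e + g e +_) (W-+ f g E)) (interchange (f e) (g e) _ _)

W-0 : ∀ {n} (E : List (Edge n)) → W (λ _ → 0) E ≡ 0
W-0 []      = refl
W-0 (e ∷ E) = W-0 E

Σ-W : ∀ {m n} (g : Fin m → ℕ) (h : Fin m → Edge n → ℕ) (E : List (Edge n)) →
      Σ-fin (λ r → g r * W (h r) E) ≡ W (λ e → Σ-fin (λ r → g r * h r e)) E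
Σ-W {m} g h []      = trans (Σ-cong (λ r → *-zeroʳ (g r))) (Σ-0 m)
Σ-W     g h (e ∷ E) = trans (Σ-cong (λ r → *-distribˡ-+ (g r) (h r e) (W (h r) E)))
  (trans (Σ-+ (λ r → g r * h r e) (λ r → g r * W (h r) E)) (cong (_ +_) (Σ-W g h E)))

inc : ∀ {n} → Fin n → Edge n → ℕ
inc v (a , b) = δ a v + δ b v

deg : ∀ {n} → Fin n → List (Edge n) → ℕ
deg v = W (inc v)

Σ-inc : ∀ {n} (g : Fin n → ℕ) (e : Edge n) → Σ-fin (λ v → g v * inc v e) ≡ g (proj₁ e) + g (proj₂ e)
Σ-inc g (a , b) = trans (Σ-cong (λ v → trans (*-comm (g v) _) (*-distribʳ-+ (g v) (δ a v) (δ b v))))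
  (trans (Σ-+ (λ v → δ a v * g v) (λ v → δ b v * g v)) (cong₂ _+_ (Σ-δ a g) (Σ-δ b g)))

-- Double counting with an arbitrary vertex weight. The constant weight gives the usual handshake
-- lemma, an indicator counts the edge ends in a set.
handshake : ∀ {n} (g : Fin n → ℕ) (E : List (Edge n)) →
            Σ-fin (λ v → g v * deg v E) ≡ W (λ e → g (proj₁ e) + g (proj₂ e)) E
handshake g E = trans (Σ-W g inc E) (W-cong E (Σ-inc g))

-- The factor 1 ∸ δ x y keeps a loop from being counted twice.
mul : ∀ {n} → Fin n → Fin n → Edge n → ℕ
mul a b (x , y) = δ x a * δ y b + (1 ∸ δ x y) * (δ x b * δ y a)

mul-flip : ∀ {n} (a b x y : Fin n) → mul a b (x , y) ≡ mul a b (y , x)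
mul-flip a b x y = go (x Fin.≟ y)
  where
  go : Dec (x ≡ y) → mul a b (x , y) ≡ mul a b (y , x)
  go (yes refl) = refl
  go (no x≢y) rewrite δ-≢ x≢y | δ-≢ (x≢y ∘ ≡-sym) | +-identityʳ (δ x b * δ y a) | +-identityʳ (δ y b * δ x a)
                   | *-comm (δ x a) (δ y b) | *-comm (δ x b) (δ y a) = +-comm (δ y b * δ x a) (δ y a * δ x b)

mul-comm : ∀ {n} (a b : Fin n) e → mul a b e ≡ mul b a e
mul-comm a b (x , y) = go (x Fin.≟ y)
  where
  go : Dec (x ≡ y) → mul a b (x , y) ≡ mul b a (x , y)
  go (yes refl) rewrite δ-refl x | +-identityʳ (δ x a * δ x b) | +-identityʳ (δ x b * δ x a) = *-comm (δ x a) (δ x b)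
  go (no x≢y) rewrite δ-≢ x≢y | +-identityʳ (δ x b * δ y a) | +-identityʳ (δ x a * δ y b) = +-comm (δ x a * δ y b) _

mul-refl : ∀ {n} (a b : Fin n) → mul a b (a , b) ≡ 1
mul-refl a b = go (a Fin.≟ b)
  where
  go : Dec (a ≡ b) → mul a b (a , b) ≡ 1
  go (yes refl) rewrite δ-refl a = refl
  go (no a≢b) rewrite δ-refl a | δ-refl b | δ-≢ a≢b = refl

mul-cases : ∀ {n} (a b x y : Fin n) →
            mul a b (x , y) ≡ 0 ⊎ (x , y) ≡ (a , b) ⊎ (x , y) ≡ (b , a)
mul-cases a b x y with x Fin.≟ a | y Fin.≟ b
... | yes refl | yes refl = inj₂ (inj₁ refl)
... | yes refl | no y≢b with x Fin.≟ b | y Fin.≟ x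
...   | yes refl | yes refl = inj₂ (inj₁ refl)
...   | no x≢b   | _        rewrite *-zeroʳ (1 ∸ δ x y) = inj₁ refl
...   | yes refl | no y≢a   rewrite *-zeroʳ (1 ∸ δ x y) = inj₁ refl
mul-cases a b x y | no x≢a | _ with x Fin.≟ b | y Fin.≟ a
...   | yes refl | yes refl = inj₂ (inj₂ refl)
...   | no _   | _          rewrite *-zeroʳ (1 ∸ δ x y) = inj₁ refl
...   | yes _ | no _        rewrite *-zeroʳ (1 ∸ δ x y) = inj₁ refl

mul-map : ∀ {m n} {f : Fin m → Fin n} → Injective _≡_ _≡_ f → ∀ a b x y →
          mul (f a) (f b) (f x , f y) ≡ mul a b (x , y)
mul-map inj a b x y rewrite δ-inj inj x a | δ-inj inj y b | δ-inj inj x y | δ-inj inj x b | δ-inj inj y a = refl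

-- The row sum sees a loop at `v` once; the added diagonal entry supplies its second incidence,
-- exactly as in `degreeOf`.
Σ-mul : ∀ {n} (v : Fin n) e → Σ-fin (λ b → mul v b e) + mul v v e ≡ inc v e
Σ-mul v (x , y) = trans (cong (_+ mul v v (x , y)) rowsum) (final (x Fin.≟ y))
  where
  open ≡-Reasoning
  c = 1 ∸ δ x y
  rowsum : Σ-fin (λ b → mul v b (x , y)) ≡ δ x v + c * δ y v
  rowsum = begin
    Σ-fin (λ b → mul v b (x , y))
      ≡⟨ Σ-+ (λ b → δ x v * δ y b) (λ b → c * (δ x b * δ y v)) ⟩
    Σ-fin (λ b → δ x v * δ y b) + Σ-fin (λ b → c * (δ x b * δ y v))
      ≡⟨ cong₂ _+_ (trans (Σ-*ˡ (δ x v) (δ y)) (trans (cong (δ x v *_) (Σ-δ₁ y)) (*-identityʳ _)))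
                   (trans (Σ-*ˡ c (λ b → δ x b * δ y v)) (cong (c *_) (Σ-δ x (λ _ → δ y v)))) ⟩
    δ x v + c * δ y v ∎
  final : Dec (x ≡ y) → δ x v + c * δ y v + mul v v (x , y) ≡ inc v (x , y)
  final (yes refl) rewrite δ-refl x with does (x Fin.≟ v)
  ... | true  = refl
  ... | false = refl
  final (no x≢y) rewrite δ-≢ x≢y with x Fin.≟ v | y Fin.≟ v
  ... | yes refl | yes refl = contradiction refl x≢y
  ... | yes _ | no _ = refl
  ... | no _  | yes _ = refl
  ... | no _  | no _ = refl

degreeOf-mul : ∀ {n} (E : List (Edge n)) v → degreeOf (λ a b → W (mul a b) E) v ≡ deg v E
degreeOf-mul E v = begin
  Σ-fin (λ b → W (mul v b) E) + W (mul v v) E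
    ≡⟨ cong (_+ W (mul v v) E) (Σ-cong (λ b → ≡-sym (+-identityʳ (W (mul v b) E)))) ⟩
  Σ-fin (λ b → 1 * W (mul v b) E) + W (mul v v) E
    ≡⟨ cong (_+ W (mul v v) E) (Σ-W (λ _ → 1) (mul v) E) ⟩
  W (λ e → Σ-fin (λ b → 1 * mul v b e)) E + W (mul v v) E
    ≡⟨ cong (_+ W (mul v v) E) (W-cong E (λ e → Σ-cong (λ b → +-identityʳ (mul v b e)))) ⟩
  W (λ e → Σ-fin (λ b → mul v b e)) E + W (mul v v) E
    ≡⟨ ≡-sym (W-+ (λ e → Σ-fin (λ b → mul v b e)) (mul v v) E) ⟩
  W (λ e → Σ-fin (λ b → mul v b e) + mul v v e) E
    ≡⟨ W-cong E (Σ-mul v) ⟩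
  deg v E ∎
  where open ≡-Reasoning

-- Equality of multigraphs: edges may be permuted and reversed.
infix 4 _≈_

data _≈_ {n} : List (Edge n) → List (Edge n) → Set where
  ≈-refl  : ∀ {E} → E ≈ E
  ≈-prep  : ∀ e {E E′} → E ≈ E′ → e ∷ E ≈ e ∷ E′
  ≈-swap  : ∀ d e {E} → d ∷ e ∷ E ≈ e ∷ d ∷ E
  ≈-flip  : ∀ a b {E} → (a , b) ∷ E ≈ (b , a) ∷ E
  ≈-trans : ∀ {E E′ E″} → E ≈ E′ → E′ ≈ E″ → E ≈ E″

≈-sym : ∀ {n} {E E′ : List (Edge n)} → E ≈ E′ → E′ ≈ E
≈-sym ≈-refl        = ≈-refl
≈-sym (≈-prep e p)  = ≈-prep e (≈-sym p)
≈-sym (≈-swap d e)  = ≈-swap e d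
≈-sym (≈-flip a b)  = ≈-flip b a
≈-sym (≈-trans p q) = ≈-trans (≈-sym q) (≈-sym p)

≈-pull : ∀ {n} {d e : Edge n} {E E′} → E ≈ e ∷ E′ → d ∷ E ≈ e ∷ d ∷ E′
≈-pull {d = d} {e} p = ≈-trans (≈-prep d p) (≈-swap d e)

≈-shift : ∀ {n} (C : List (Edge n)) {e M} → e ∷ C ++ M ≈ C ++ e ∷ M
≈-shift []      = ≈-refl
≈-shift (d ∷ C) {e} = ≈-trans (≈-swap e d) (≈-prep d (≈-shift C))

≈-++ʳ : ∀ {n} (C : List (Edge n)) {M M′} → M ≈ M′ → C ++ M ≈ C ++ M′
≈-++ʳ []      p = p
≈-++ʳ (d ∷ C) p = ≈-prep d (≈-++ʳ C p)

All-≈ : ∀ {n} {P : Edge n → Set} → (∀ a b → P (a , b) → P (b , a)) → ∀ {E E′} → E ≈ E′ → All P E → All P E′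
All-≈ s ≈-refl        h           = h
All-≈ s (≈-prep e p)  (x ∷ h)     = x ∷ All-≈ s p h
All-≈ s (≈-swap d e)  (x ∷ y ∷ h) = y ∷ x ∷ h
All-≈ s (≈-flip a b)  (x ∷ h)     = s a b x ∷ h
All-≈ s (≈-trans p q) h           = All-≈ s q (All-≈ s p h)

Symm : ∀ {n} → (Edge n → ℕ) → Set
Symm f = ∀ a b → f (a , b) ≡ f (b , a)

W-≈ : ∀ {n} {f : Edge n → ℕ} → Symm f → ∀ {E E′} → E ≈ E′ → W f E ≡ W f E′
W-≈     s ≈-refl        = refl
W-≈ {f = f} s (≈-prep e p)  = cong (f e +_) (W-≈ s p)
W-≈ {f = f} s (≈-swap d e {E}) = x∙yz≈y∙xz (f d) (f e) (W f E)
W-≈ {f = f} s (≈-flip a b {E}) = cong (_+ W f E) (s a b)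
W-≈     s (≈-trans p q) = trans (W-≈ s p) (W-≈ s q)

inc-flip : ∀ {n} (v : Fin n) → Symm (inc v)
inc-flip v a b = +-comm (δ a v) (δ b v)

deg-≈ : ∀ {n} (v : Fin n) {E E′} → E ≈ E′ → deg v E ≡ deg v E′
deg-≈ v = W-≈ (inc-flip v)

pull-mul : ∀ {n} (a b : Fin n) E → 1 ≤ W (mul a b) E → ∃ λ E′ → E ≈ (a , b) ∷ E′
pull-mul a b ((x , y) ∷ E) h with mul-cases a b x y
... | inj₂ (inj₁ refl) = E , ≈-refl
... | inj₂ (inj₂ refl) = E , ≈-flip b a
... | inj₁ m≡0 with pull-mul a b E (subst (λ m → 1 ≤ m + W (mul a b) E) m≡0 h)
...   | E′ , p = (x , y) ∷ E′ , ≈-pull p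

-- Comparing multiplicities, rather than mere adjacency, allows `K` to repeat edges: pulling out one
-- edge lowers both sides by the same `mul`, so the condition survives for the rest of `K`.
pull-all : ∀ {n} (K E : List (Edge n)) →
           All (λ (a , b) → W (mul a b) K ≤ W (mul a b) E) K → ∃ λ E′ → E ≈ K ++ E′
pull-all [] E [] = E , ≈-refl
pull-all ((a , b) ∷ K) E (h ∷ hs)
  with pull-mul a b E (≤-trans (subst (λ m → 1 ≤ m + W (mul a b) K) (≡-sym (mul-refl a b)) (s≤s z≤n)) h)
... | E₁ , p with pull-all K E₁ (All.map cancel hs)
  where
  cancel : ∀ {e} → W (mul (proj₁ e) (proj₂ e)) ((a , b) ∷ K) ≤ W (mul (proj₁ e) (proj₂ e)) E →
           W (mul (proj₁ e) (proj₂ e)) K ≤ W (mul (proj₁ e) (proj₂ e)) E₁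
  cancel {c , d} le = +-cancelˡ-≤ (mul c d (a , b)) _ _
    (≤-trans le (≤-reflexive (W-≈ (mul-flip c d) p)))
... | E′ , q = E′ , ≈-trans p (≈-prep (a , b) q)

pull-deg : ∀ {n} (v : Fin n) E → 1 ≤ deg v E → ∃ λ a → ∃ λ E′ → E ≈ (v , a) ∷ E′
pull-deg v ((x , y) ∷ E) h with x Fin.≟ v | y Fin.≟ v
... | yes refl | _        = y , E , ≈-refl
... | no _     | yes refl = x , E , ≈-flip x y
... | no _     | no _ with pull-deg v E h
...   | a , E′ , p = a , (x , y) ∷ E′ , ≈-pull p

-- Red/blue colourings of an edge list

Colouring : ∀ {n} → List (Edge n) → Set
Colouring = All (λ _ → Bool)

red : ∀ {n} {E : List (Edge n)} → Colouring E → List (Edge n)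
red []                       = []
red {E = e ∷ _} (true  ∷ cs) = e ∷ red cs
red             (false ∷ cs) = red cs

W-red-≤ : ∀ {n} (f : Edge n → ℕ) {E : List (Edge n)} (cs : Colouring E) → W f (red cs) ≤ W f E
W-red-≤ f []               = z≤n
W-red-≤ f {e ∷ E} (true  ∷ cs) = +-monoʳ-≤ (f e) (W-red-≤ f cs)
W-red-≤ f {e ∷ E} (false ∷ cs) = ≤-trans (W-red-≤ f cs) (m≤n+m _ (f e))

opposite : ∀ {n} {E : List (Edge n)} → Colouring E → Colouring E
opposite = All.map not

W-opposite : ∀ {n} (f : Edge n → ℕ) {E : List (Edge n)} (cs : Colouring E) →
             W f (red cs) + W f (red (opposite cs)) ≡ W f E
W-opposite f [] = refl
W-opposite f {e ∷ E} (true ∷ cs) = trans (+-assoc (f e) _ _) (cong (f e +_) (W-opposite f cs))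
W-opposite f {e ∷ E} (false ∷ cs) =
  trans (x∙yz≈y∙xz (W f (red cs)) (f e) _) (cong (f e +_) (W-opposite f cs))

-- Colours travel with their edges, so the red part is rearranged as well and every red degree is
-- preserved.
recolour : ∀ {n} {E E′ : List (Edge n)} → E ≈ E′ → (cs : Colouring E) → Σ (Colouring E′) λ cs′ → red cs ≈ red cs′
recolour ≈-refl cs = cs , ≈-refl
recolour (≈-prep e p) (true ∷ cs) with recolour p cs
... | cs′ , q = true ∷ cs′ , ≈-prep e q
recolour (≈-prep e p) (false ∷ cs) with recolour p cs
... | cs′ , q = false ∷ cs′ , q
recolour (≈-swap d e) (true  ∷ true  ∷ cs) = true ∷ true ∷ cs , ≈-swap d e
recolour (≈-swap d e) (true  ∷ false ∷ cs) = false ∷ true ∷ cs , ≈-refl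
recolour (≈-swap d e) (false ∷ true  ∷ cs) = true ∷ false ∷ cs , ≈-refl
recolour (≈-swap d e) (false ∷ false ∷ cs) = false ∷ false ∷ cs , ≈-refl
recolour (≈-flip a b) (true  ∷ cs) = true ∷ cs , ≈-flip a b
recolour (≈-flip a b) (false ∷ cs) = false ∷ cs , ≈-refl
recolour (≈-trans p q) cs with recolour p cs
... | cs′ , r with recolour q cs′
...   | cs″ , s = cs″ , ≈-trans r s

infixr 5 _++ᶜ_
_++ᶜ_ : ∀ {n} {E E′ : List (Edge n)} → Colouring E → Colouring E′ → Colouring (E ++ E′)
[]       ++ᶜ ds = ds
(c ∷ cs) ++ᶜ ds = c ∷ (cs ++ᶜ ds)

W-red-++ : ∀ {n} (f : Edge n → ℕ) {E E′ : List (Edge n)} (cs : Colouring E) (ds : Colouring E′) →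
           W f (red (cs ++ᶜ ds)) ≡ W f (red cs) + W f (red ds)
W-red-++ f [] ds = refl
W-red-++ f {e ∷ _} (true ∷ cs) ds = trans (cong (f e +_) (W-red-++ f cs ds)) (≡-sym (+-assoc (f e) _ _))
W-red-++ f (false ∷ cs) ds = W-red-++ f cs ds

splitᶜ : ∀ {n} (J : List (Edge n)) {H} (cs : Colouring (J ++ H)) →
         Σ (Colouring J) λ js → Σ (Colouring H) λ hs → js ++ᶜ hs ≡ cs
splitᶜ [] cs = [] , cs , refl
splitᶜ (e ∷ J) (c ∷ cs) with splitᶜ J cs
... | js , hs , refl = c ∷ js , hs , refl

mapᴱ : ∀ {m n} → (Fin m → Fin n) → List (Edge m) → List (Edge n)
mapᴱ f []            = []
mapᴱ f ((a , b) ∷ E) = (f a , f b) ∷ mapᴱ f E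

mapᶜ : ∀ {m n} (f : Fin m → Fin n) {E : List (Edge m)} → Colouring E → Colouring (mapᴱ f E)
mapᶜ f []       = []
mapᶜ f (c ∷ cs) = c ∷ mapᶜ f cs

unmapᶜ : ∀ {m n} (f : Fin m → Fin n) {E : List (Edge m)} → Colouring (mapᴱ f E) → Colouring E
unmapᶜ f {[]}    []       = []
unmapᶜ f {e ∷ E} (c ∷ cs) = c ∷ unmapᶜ f cs

red-mapᶜ : ∀ {m n} (f : Fin m → Fin n) {E : List (Edge m)} (cs : Colouring E) → red (mapᶜ f cs) ≡ mapᴱ f (red cs)
red-mapᶜ f []           = refl
red-mapᶜ f (true ∷ cs)  = cong (_ ∷_) (red-mapᶜ f cs)
red-mapᶜ f (false ∷ cs) = red-mapᶜ f cs

red-unmapᶜ : ∀ {m n} (f : Fin m → Fin n) {E : List (Edge m)} (cs : Colouring (mapᴱ f E)) →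
             red cs ≡ mapᴱ f (red (unmapᶜ f cs))
red-unmapᶜ f {[]}    []           = refl
red-unmapᶜ f {e ∷ E} (true ∷ cs)  = cong (_ ∷_) (red-unmapᶜ f cs)
red-unmapᶜ f {e ∷ E} (false ∷ cs) = red-unmapᶜ f cs

W-map : ∀ {m n} (g : Edge n → ℕ) (f : Fin m → Fin n) E →
        W g (mapᴱ f E) ≡ W (λ (a , b) → g (f a , f b)) E
W-map g f []      = refl
W-map g f (e ∷ E) = cong (_ +_) (W-map g f E)

deg-map : ∀ {m n} {f : Fin m → Fin n} → Injective _≡_ _≡_ f → ∀ i E → deg (f i) (mapᴱ f E) ≡ deg i E
deg-map {f = f} inj i E = trans (W-map (inc (f i)) f E)
  (W-cong E (λ (a , b) → cong₂ _+_ (δ-inj inj a i) (δ-inj inj b i)))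

mul-mapᴱ : ∀ {m n} {f : Fin m → Fin n} → Injective _≡_ _≡_ f → ∀ a b E →
           W (mul (f a) (f b)) (mapᴱ f E) ≡ W (mul a b) E
mul-mapᴱ {f = f} inj a b E = trans (W-map (mul (f a) (f b)) f E) (W-cong E (λ (x , y) → mul-map inj a b x y))

-- From multiplicity matrices to edge lists and back

concatF : ∀ {m n} → (Fin m → List (Edge n)) → List (Edge n)
concatF {zero}  g = []
concatF {suc m} g = g zero ++ concatF (g ∘ suc)

W-concatF : ∀ {m n} (f : Edge n → ℕ) (g : Fin m → List (Edge n)) →
            W f (concatF g) ≡ Σ-fin (λ i → W f (g i))
W-concatF {zero}  f g = refl
W-concatF {suc m} f g = trans (W-++ f (g zero) _)
  (trans (cong (W f (g zero) +_) (W-concatF f (g ∘ suc))) (≡-sym (Σ-suc (λ i → W f (g i)))))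

W-replicate : ∀ {n} (f : Edge n → ℕ) k e → W f (replicate k e) ≡ k * f e
W-replicate f zero    e = refl
W-replicate f (suc k) e = cong (f e +_) (W-replicate f k e)

edgesOf : ∀ {n} (A : Fin n → Fin n → ℕ) → (∀ i j → A i j ≡ A j i) →
          ∃ λ E → ∀ a b → W (mul a b) E ≡ A a b
edgesOf A A-sym = E , λ a b → trans (W-E a b) (final a b)
  where
  open ≡-Reasoning
  -- Only the upper triangle is listed, so that each unordered pair, and each loop, is produced
  -- once.
  T : _ → _ → ℕ
  T i j with toℕ i ≤? toℕ j
  ... | yes _ = A i j
  ... | no  _ = 0
  E = concatF (λ i → concatF (λ j → replicate (T i j) (i , j)))
  term : ∀ a b i j → T i j * mul a b (i , j) ≡
         δ a i * (δ b j * T i j) + δ b i * (δ a j * (T i j * (1 ∸ δ i j)))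
  term a b i j rewrite δ-comm a i | δ-comm a j | δ-comm b i | δ-comm b j
    = solve 6 (λ t ia jb c ib ja → t :* (ia :* jb :+ c :* (ib :* ja)) := ia :* (jb :* t) :+ ib :* (ja :* (t :* c)))
            refl (T i j) (δ i a) (δ j b) (1 ∸ δ i j) (δ i b) (δ j a)
  W-E : ∀ a b → W (mul a b) E ≡ T a b + T b a * (1 ∸ δ b a)
  W-E a b = begin
    W (mul a b) E
      ≡⟨ trans (W-concatF (mul a b) (λ i → concatF (λ j → replicate (T i j) (i , j))))
         (Σ-cong (λ i → trans (W-concatF (mul a b) (λ j → replicate (T i j) (i , j)))
                 (Σ-cong (λ j → trans (W-replicate (mul a b) (T i j) (i , j)) (term a b i j))))) ⟩
    Σ-fin (λ i → Σ-fin (λ j → δ a i * (δ b j * T i j) + δ b i * (δ a j * (T i j * (1 ∸ δ i j)))))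
      ≡⟨ Σ-cong (λ i → trans (Σ-+ (λ j → δ a i * (δ b j * T i j)) (λ j → δ b i * (δ a j * (T i j * (1 ∸ δ i j)))))
           (cong₂ _+_ (trans (Σ-*ˡ (δ a i) (λ j → δ b j * T i j)) (cong (δ a i *_) (Σ-δ b (T i))))
                      (trans (Σ-*ˡ (δ b i) (λ j → δ a j * (T i j * (1 ∸ δ i j))))
                             (cong (δ b i *_) (Σ-δ a (λ j → T i j * (1 ∸ δ i j))))))) ⟩
    Σ-fin (λ i → δ a i * T i b + δ b i * (T i a * (1 ∸ δ i a)))
      ≡⟨ trans (Σ-+ (λ i → δ a i * T i b) (λ i → δ b i * (T i a * (1 ∸ δ i a))))
               (cong₂ _+_ (Σ-δ a (λ i → T i b)) (Σ-δ b (λ i → T i a * (1 ∸ δ i a)))) ⟩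
    T a b + T b a * (1 ∸ δ b a) ∎
  final : ∀ a b → T a b + T b a * (1 ∸ δ b a) ≡ A a b
  final a b with b Fin.≟ a
  final a b | yes refl with toℕ a ≤? toℕ a
  ... | yes _ = trans (cong (A a a +_) (*-zeroʳ (A a a))) (+-identityʳ _)
  ... | no a≰a = contradiction ≤-refl a≰a
  final a b | no b≢a with toℕ a ≤? toℕ b | toℕ b ≤? toℕ a
  ... | yes p | yes q = contradiction (Finₚ.toℕ-injective (≤-antisym q p)) b≢a
  ... | yes p | no _  = +-identityʳ _
  ... | no _  | yes q = trans (*-identityʳ _) (A-sym b a)
  ... | no p  | no q  = contradiction (<⇒≤ (≰⇒> p)) q

-- Greedy: an edge stays blue when the later copies of its pair can still provide all that `F` asks
-- for. Otherwise `F` is positive there, the edge becomes red and `F` drops by one at that pair.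
colouringOf : ∀ {n} (E : List (Edge n)) (F : Fin n → Fin n → ℕ) → (∀ i j → F i j ≡ F j i) →
              (∀ i j → F i j ≤ W (mul i j) E) →
              Σ (Colouring E) λ cs → ∀ i j → W (mul i j) (red cs) ≡ F i j
colouringOf [] F F-sym F≤ = [] , λ i j → ≡-sym (n≤0⇒n≡0 (F≤ i j))
colouringOf ((x , y) ∷ E) F F-sym F≤ with F x y ≤? W (mul x y) E
... | yes le with colouringOf E F F-sym F≤′
  where
  F≤′ : ∀ i j → F i j ≤ W (mul i j) E
  F≤′ i j with mul-cases i j x y
  ... | inj₁ m≡0 = subst (λ m → F i j ≤ m + W (mul i j) E) m≡0 (F≤ i j)
  ... | inj₂ (inj₁ refl) = le
  ... | inj₂ (inj₂ refl) = subst₂ _≤_ (F-sym j i) (W-cong E (mul-comm j i)) le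
... | cs , h = false ∷ cs , h
colouringOf ((x , y) ∷ E) F F-sym F≤ | no nle
  with colouringOf E (λ i j → F i j ∸ mul i j (x , y))
         (λ i j → cong₂ _∸_ (F-sym i j) (mul-comm i j (x , y)))
         (λ i j → m≤n+o⇒m∸n≤o (F i j) (mul i j (x , y)) (F≤ i j))
... | cs , h = true ∷ cs , λ i j → trans (cong (mul i j (x , y) +_) (h i j)) (m+[n∸m]≡n (mul≤ i j))
  where
  pos : 1 ≤ F x y
  pos = ≤-trans (s≤s z≤n) (≰⇒> nle)
  mul≤ : ∀ i j → mul i j (x , y) ≤ F i j
  mul≤ i j with mul-cases i j x y
  ... | inj₁ m≡0 = subst (_≤ F i j) (≡-sym m≡0) z≤n
  ... | inj₂ (inj₁ refl) = subst (_≤ F x y) (≡-sym (mul-refl x y)) pos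
  ... | inj₂ (inj₂ refl) = subst₂ _≤_ (≡-sym (trans (mul-comm i j (j , i)) (mul-refl j i))) (F-sym j i) pos

-- Minimality for edge lists

Legal : ℕ → Set
Legal d = d ≡ 4 ⊎ d ≡ 1

-- Vertices are deleted by shrinking the mask A rather than the type Fin n.
FactorOn : ∀ {n} → (Fin n → Bool) → List (Edge n) → Set
FactorOn A E = Σ (Colouring E) λ cs → ∀ v → A v ≡ true → Legal (deg v (red cs))

RegularOn : ∀ {n} → ℕ → (Fin n → Bool) → List (Edge n) → Set
RegularOn k A E = (∀ v → A v ≡ true → deg v E ≡ k) × (∀ v → A v ≡ false → deg v E ≡ 0)

degreeOf-cong : ∀ {n} {A B : Fin n → Fin n → ℕ} → (∀ i j → A i j ≡ B i j) → ∀ v → degreeOf A v ≡ degreeOf B v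
degreeOf-cong h v = cong₂ _+_ (Σ-cong (h v)) (h v v)

factorFrom : (G : Graph) (E : List (Edge (n G))) → (∀ a b → W (mul a b) E ≡ adj G a b) →
             FactorOn (λ _ → true) E → Factor41 G
factorFrom G E h (cs , legal) = record
  { F     = λ a b → W (mul a b) (red cs)
  ; F-sym = λ a b → W-cong (red cs) (mul-comm a b)
  ; F-sub = λ a b → subst (W (mul a b) (red cs) ≤_) (h a b) (W-red-≤ (mul a b) cs)
  ; F-deg = λ v → subst Legal (≡-sym (degreeOf-mul (red cs) v)) (legal v refl)
  }

graphOf : ∀ {n} → List (Edge n) → Graph
graphOf {n} E = record { n = n ; adj = λ a b → W (mul a b) E ; sym = λ a b → W-cong E (mul-comm a b) }

factorTo : ∀ {n} (E : List (Edge n)) → Factor41 (graphOf E) →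
           Σ (Colouring E) λ cs → ∀ v → Legal (deg v (red cs))
factorTo E f with colouringOf E (Factor41.F f) (Factor41.F-sym f) (Factor41.F-sub f)
... | cs , h = cs , λ v → subst Legal
  (trans (degreeOf-cong (λ i j → ≡-sym (h i j)) v) (degreeOf-mul (red cs) v)) (Factor41.F-deg f v)

-- Minimality speaks of graphs on a full `Fin n`; this identifies the vertices selected by a mask
-- with such a type.
record Enumeration {n} (A : Fin n → Bool) : Set where
  field
    size : ℕ
    size≡ : size ≡ count A
    ι    : Fin size → Fin n
    ι-inj : Injective _≡_ _≡_ ι
    ι-in  : ∀ i → A (ι i) ≡ true
    ι-onto : ∀ v → A v ≡ true → ∃ λ i → ι i ≡ v

enumerate : ∀ {n} (A : Fin n → Bool) → Enumeration A
enumerate {zero}  A = record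
  { size = 0 ; size≡ = refl ; ι = λ () ; ι-inj = λ {} ; ι-in = λ () ; ι-onto = λ () }
enumerate {suc n} A with enumerate (A ∘ suc) | A zero in eq
... | R | false = record
  { size   = size
  ; size≡  = trans size≡ (trans (cong (λ b → bit b + count (A ∘ suc)) (≡-sym eq)) (≡-sym (Σ-suc (bit ∘ A))))
  ; ι      = suc ∘ ι
  ; ι-inj  = ι-inj ∘ Finₚ.suc-injective
  ; ι-in   = ι-in
  ; ι-onto = onto
  }
  where
  open Enumeration R
  onto : ∀ v → A v ≡ true → ∃ λ i → suc (ι i) ≡ v
  onto zero h with () ← trans (≡-sym h) eq
  onto (suc v) h with ι-onto v h
  ... | i , p = i , cong suc p
... | R | true = record
  { size   = suc size
  ; size≡  = trans (cong suc size≡) (trans (cong (λ b → bit b + count (A ∘ suc)) (≡-sym eq)) (≡-sym (Σ-suc (bit ∘ A))))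
  ; ι      = ι′
  ; ι-inj  = inj
  ; ι-in   = λ { zero → eq ; (suc i) → ι-in i }
  ; ι-onto = onto
  }
  where
  open Enumeration R
  ι′ : Fin (suc size) → Fin (suc n)
  ι′ zero    = zero
  ι′ (suc i) = suc (ι i)
  inj : Injective _≡_ _≡_ ι′
  inj {zero}  {zero}  _ = refl
  inj {suc i} {suc j} p = cong suc (ι-inj (Finₚ.suc-injective p))
  onto : ∀ v → A v ≡ true → ∃ λ i → ι′ i ≡ v
  onto zero    h = zero , refl
  onto (suc v) h with ι-onto v h
  ... | i , p = suc i , cong suc p

deg-∷-head : ∀ {n} (a b : Fin n) E → 1 ≤ deg a ((a , b) ∷ E)
deg-∷-head a b E rewrite δ-refl a = s≤s z≤n

deg-∷-head₂ : ∀ {n} (a b : Fin n) E → 1 ≤ deg b ((a , b) ∷ E)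
deg-∷-head₂ a b E = subst (1 ≤_) (deg-≈ b (≈-flip b a {E})) (deg-∷-head b a E)

alive : ∀ {n} {A : Fin n → Bool} {v} (E : List (Edge n)) →
        (∀ v → A v ≡ false → deg v E ≡ 0) → 1 ≤ deg v E → A v ≡ true
alive {A = A} {v} E dead h with A v in eq
... | true  = refl
... | false = contradiction (subst (1 ≤_) (dead v eq) h) λ ()

relabel : ∀ {n} {A : Fin n → Bool} (R : Enumeration A) (E : List (Edge n)) →
          (∀ v → A v ≡ false → deg v E ≡ 0) → ∃ λ E′ → mapᴱ (Enumeration.ι R) E′ ≡ E
relabel R [] dead = [] , refl
relabel {A = A} R ((a , b) ∷ E) dead
  with Enumeration.ι-onto R a (alive {A = A} ((a , b) ∷ E) dead (deg-∷-head a b E))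
     | Enumeration.ι-onto R b (alive {A = A} ((a , b) ∷ E) dead (deg-∷-head₂ a b E))
     | relabel {A = A} R E (λ v p → m+n≡0⇒n≡0 (inc v (a , b)) (dead v p))
... | i , refl | j , refl | E′ , refl = (i , j) ∷ E′ , refl

Minimal : ℕ → Set
Minimal N = (H : Graph) → Regular 5 H → n H < N → Factor41 H

-- Vertices outside the mask are isolated, so the edge list is the image of a list on the enumerated
-- vertices. Every appeal to minimality passes through here.
factorOnSmaller : ∀ {N} → Minimal N → (A : Fin N → Bool) → count A < N →
                  (E : List (Edge N)) → RegularOn 5 A E → FactorOn A E
factorOnSmaller {N} minimal A small E (reg , dead) with enumerate A
... | R with relabel R E dead
...   | E′ , refl with factorTo E′ (minimal (graphOf E′) regular (subst (_< N) (≡-sym (Enumeration.size≡ R)) small))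
  where
  open Enumeration R
  regular : Regular 5 (graphOf E′)
  regular i = trans (degreeOf-mul E′ i) (trans (≡-sym (deg-map ι-inj i E′)) (reg (ι i) (ι-in i)))
...     | cs , legal = mapᶜ ι cs , λ v Av → let i , p = ι-onto v Av in
          subst (λ v → Legal (deg v (red (mapᶜ ι cs)))) p
            (subst Legal (≡-sym (trans (cong (deg (ι i)) (red-mapᶜ ι cs)) (deg-map ι-inj i (red cs)))) (legal i))
  where open Enumeration R

-- Reductions

-- H arises from E by removing the vertices in Gone; colourings of H lift to E with the same red degrees
-- at the remaining vertices, and with red degrees satisfying Q.
record Reduction {n} (E : List (Edge n)) (Gone : Fin n → Set) (Q : (Fin n → ℕ) → Set) : Set where
  field
    H      : List (Edge n)
    gone   : ∀ z → Gone z → deg z H ≡ 0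
    kept   : ∀ z → ¬ Gone z → deg z H ≡ deg z E
    lift   : (cs : Colouring H) → Σ (Colouring E) λ cs′ →
             (∀ z → ¬ Gone z → deg z (red cs′) ≡ deg z (red cs)) × Q (λ z → deg z (red cs′))

module _ {n : ℕ} where

  inc-≢ : ∀ {v a b : Fin n} → a ≢ v → b ≢ v → inc v (a , b) ≡ 0
  inc-≢ a≢v b≢v rewrite δ-≢ a≢v | δ-≢ b≢v = refl

  inc-left : ∀ {v b : Fin n} → b ≢ v → inc v (v , b) ≡ 1
  inc-left {v} b≢v rewrite δ-refl v | δ-≢ b≢v = refl

  inc-right : ∀ {v a : Fin n} → a ≢ v → inc v (a , v) ≡ 1
  inc-right {v} a≢v rewrite δ-refl v | δ-≢ a≢v = refl

  inc-loop : ∀ (v : Fin n) → inc v (v , v) ≡ 2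
  inc-loop v rewrite δ-refl v = refl

  deg-opened : ∀ {E : List (Edge n)} v {d} k {e E′} → E ≈ e ∷ E′ → deg v E ≡ k + d → inc v e ≡ k → deg v E′ ≡ d
  deg-opened v {d} k {e} p h q = +-cancelˡ-≡ k _ _ (trans (cong (_+ _) (≡-sym q)) (trans (≡-sym (deg-≈ v p)) h))

  Two : Fin n → Fin n → Fin n → Set
  Two u v z = z ≡ u ⊎ z ≡ v

  SameDegree : Fin n → Fin n → (Fin n → ℕ) → Set
  SameDegree u v d = d u ≡ d v

  PairReduction : List (Edge n) → Fin n → Fin n → Set
  PairReduction E u v = Reduction E (Two u v) (SameDegree u v)

  swapPair : ∀ {E u v} → PairReduction E u v → PairReduction E v u
  swapPair R = record
    { H = H
    ; gone = λ z → gone z ∘ sw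
    ; kept = λ z ¬g → kept z (¬g ∘ sw)
    ; lift = λ cs → let cs′ , k , q = lift cs in cs′ , (λ z ¬g → k z (¬g ∘ sw)) , ≡-sym q
    }
    where
    open Reduction R
    sw : ∀ {z u v} → Two u v z → Two v u z
    sw (inj₁ p) = inj₂ p
    sw (inj₂ p) = inj₁ p

  -- The edges K at the removed vertices are replaced by the edges J; `spread` colours K from a colouring of J.
  extend : ∀ {E E₁ : List (Edge n)} {u v} (J K : List (Edge n)) → E ≈ K ++ E₁ → PairReduction E₁ u v →
           (∀ z → Two u v z → deg z J ≡ 0) →
           (∀ z → ¬ Two u v z → deg z J ≡ deg z K) →
           ((cs : Colouring J) → Σ (Colouring K) λ ks →
             (∀ z → ¬ Two u v z → deg z (red ks) ≡ deg z (red cs)) × deg u (red ks) ≡ deg v (red ks)) →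
           PairReduction E u v
  extend {E} {E₁} {u} {v} J K E≈ R J-gone J-kept spread = record
    { H = J ++ H
    ; gone = λ z g → trans (W-++ (inc z) J H) (cong₂ _+_ (J-gone z g) (gone z g))
    ; kept = λ z ¬g → trans (W-++ (inc z) J H) (trans (cong₂ _+_ (J-kept z ¬g) (kept z ¬g))
                      (≡-sym (trans (deg-≈ z E≈) (W-++ (inc z) K E₁))))
    ; lift = lift′
    }
    where
    open Reduction R
    lift′ : (cs : Colouring (J ++ H)) → Σ (Colouring E) λ cs′ →
            (∀ z → ¬ Two u v z → deg z (red cs′) ≡ deg z (red cs)) × deg u (red cs′) ≡ deg v (red cs′)
    lift′ cs with splitᶜ J cs
    ... | js , hs , refl with spread js | lift hs
    ...   | ks , k₁ , q₁ | es , k₂ , q₂ with recolour (≈-sym E≈) (ks ++ᶜ es)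
    ...     | cs′ , p = cs′
      , (λ z ¬g → trans (at z) (trans (cong₂ _+_ (k₁ z ¬g) (k₂ z ¬g)) (≡-sym (W-red-++ (inc z) js hs))))
      , trans (at u) (trans (cong₂ _+_ q₁ q₂) (≡-sym (at v)))
      where
      at : ∀ z → deg z (red cs′) ≡ deg z (red ks) + deg z (red es)
      at z = trans (≡-sym (deg-≈ z p)) (W-red-++ (inc z) ks es)

  away : ∀ {u v z : Fin n} → ¬ Two u v z → u ≢ z × v ≢ z
  away ¬g = (λ p → ¬g (inj₁ (≡-sym p))) , (λ p → ¬g (inj₂ (≡-sym p)))

  inc-other : ∀ {u z a : Fin n} → u ≢ z → inc z (u , a) ≡ δ a z
  inc-other u≢z rewrite δ-≢ u≢z = refl

  gone₂ : ∀ {u v a b : Fin n} → a ≢ u → a ≢ v → b ≢ u → b ≢ v → ∀ z → Two u v z → deg z ((a , b) ∷ []) ≡ 0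
  gone₂ a≢u a≢v b≢u b≢v z (inj₁ refl) = trans (+-identityʳ _) (inc-≢ a≢u b≢u)
  gone₂ a≢u a≢v b≢u b≢v z (inj₂ refl) = trans (+-identityʳ _) (inc-≢ a≢v b≢v)

  parallelStep : ∀ {E E₁ : List (Edge n)} {u v} → E ≈ (u , v) ∷ E₁ → PairReduction E₁ u v → PairReduction E u v
  parallelStep {u = u} {v} p R = extend [] ((u , v) ∷ []) p R (λ _ _ → refl)
    (λ z ¬g → let u≢z , v≢z = away ¬g in ≡-sym (trans (+-identityʳ _) (inc-≢ u≢z v≢z)))
    (λ { [] → false ∷ [] , (λ _ _ → refl) , refl })

  loopsStep : ∀ {E E₁ : List (Edge n)} {u v} → E ≈ (u , u) ∷ (v , v) ∷ E₁ → PairReduction E₁ u v → PairReduction E u v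
  loopsStep {u = u} {v} p R = extend [] ((u , u) ∷ (v , v) ∷ []) p R (λ _ _ → refl)
    (λ z ¬g → let u≢z , v≢z = away ¬g in ≡-sym (cong₂ _+_ (inc-≢ u≢z u≢z) (cong (_+ 0) (inc-≢ v≢z v≢z))))
    (λ { [] → false ∷ false ∷ [] , (λ _ _ → refl) , refl })

  simpleStep : ∀ {E E₁ : List (Edge n)} {u v a b} → u ≢ v → a ≢ u → a ≢ v → b ≢ u → b ≢ v →
               E ≈ (u , a) ∷ (v , b) ∷ E₁ → PairReduction E₁ u v → PairReduction E u v
  simpleStep {u = u} {v} {a} {b} u≢v a≢u a≢v b≢u b≢v p R =
    extend ((a , b) ∷ []) ((u , a) ∷ (v , b) ∷ []) p R (gone₂ a≢u a≢v b≢u b≢v) same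
      (λ { (true ∷ []) → true ∷ true ∷ [] , (λ z ¬g → ≡-sym (same z ¬g)) ,
             trans (cong₂ _+_ (inc-left a≢u) (cong (_+ 0) (inc-≢ (u≢v ∘ ≡-sym) b≢u)))
                   (≡-sym (cong₂ _+_ (inc-≢ u≢v a≢v) (cong (_+ 0) (inc-left b≢v))))
         ; (false ∷ []) → false ∷ false ∷ [] , (λ _ _ → refl) , refl })
    where
    same : ∀ z → ¬ Two u v z → deg z ((a , b) ∷ []) ≡ deg z ((u , a) ∷ (v , b) ∷ [])
    same z ¬g = let u≢z , v≢z = away ¬g in
      trans (+-assoc (δ a z) _ _) (≡-sym (cong₂ _+_ (inc-other {a = a} u≢z) (cong (_+ 0) (inc-other {a = b} v≢z))))

  -- All three deleted edges copy the colour of the new edge `ab`: the loop then gives `u` two red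
  -- half-edges or none, and `va`, `vb` give the same number to `v`.
  mixedStep : ∀ {E E₁ : List (Edge n)} {u v a b} → u ≢ v → a ≢ u → a ≢ v → b ≢ u → b ≢ v →
              E ≈ (u , u) ∷ (v , a) ∷ (v , b) ∷ E₁ → PairReduction E₁ u v → PairReduction E u v
  mixedStep {u = u} {v} {a} {b} u≢v a≢u a≢v b≢u b≢v p R =
    extend ((a , b) ∷ []) ((u , u) ∷ (v , a) ∷ (v , b) ∷ []) p R (gone₂ a≢u a≢v b≢u b≢v) same
      (λ { (true ∷ []) → true ∷ true ∷ true ∷ [] , (λ z ¬g → ≡-sym (same z ¬g)) ,
             trans (cong₂ _+_ (inc-loop u) (cong₂ _+_ (inc-≢ (u≢v ∘ ≡-sym) a≢u) (cong (_+ 0) (inc-≢ (u≢v ∘ ≡-sym) b≢u))))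
                   (≡-sym (cong₂ _+_ (inc-≢ u≢v u≢v) (cong₂ _+_ (inc-left a≢v) (cong (_+ 0) (inc-left b≢v)))))
         ; (false ∷ []) → false ∷ false ∷ false ∷ [] , (λ _ _ → refl) , refl })
    where
    same : ∀ z → ¬ Two u v z → deg z ((a , b) ∷ []) ≡ deg z ((u , u) ∷ (v , a) ∷ (v , b) ∷ [])
    same z ¬g = let u≢z , v≢z = away ¬g in
      trans (+-assoc (δ a z) _ _) (≡-sym (cong₂ _+_ (inc-≢ u≢z u≢z)
        (cong₂ _+_ (inc-other {a = a} v≢z) (cong (_+ 0) (inc-other {a = b} v≢z)))))

  NoEdge : Fin n → Fin n → List (Edge n) → Set
  NoEdge u v E = W (mul u v) E ≡ 0

  noEdge-∷ : ∀ {u v e E E₁} → NoEdge u v E → E ≈ e ∷ E₁ → mul u v e ≡ 0 × NoEdge u v E₁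
  noEdge-∷ {u} {v} {e} h p = let q = trans (≡-sym (W-≈ (mul-flip u v) p)) h in
    m+n≡0⇒m≡0 (mul u v e) q , m+n≡0⇒n≡0 (mul u v e) q

  noEdge-≢ : ∀ (u v a : Fin n) → mul u v (u , a) ≡ 0 → a ≢ v
  noEdge-≢ u v a h refl with () ← trans (≡-sym (mul-refl u v)) h

  noEdge-≢′ : ∀ (u v a : Fin n) → mul u v (v , a) ≡ 0 → a ≢ u
  noEdge-≢′ u v a h = noEdge-≢ v u a (trans (mul-comm v u (v , a)) h)

  -- A loop at u against an edge at v: it is matched with a loop at v if there is one, else with two edges at v.
  loopAt : ∀ k {E E₁ : List (Edge n)} {u v} → u ≢ v → NoEdge u v E₁ → E ≈ (u , u) ∷ E₁ →
           deg u E₁ ≡ k → deg v E₁ ≡ 2 + k →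
           (∀ E₂ → deg u E₂ ≡ k → deg v E₂ ≡ k → PairReduction E₂ u v) → PairReduction E u v
  loopAt k {E₁ = E₁} {u} {v} u≢v none p du dv rec with pull-deg v E₁ (subst (1 ≤_) (≡-sym dv) (s≤s z≤n))
  ... | a , E₂ , q with a Fin.≟ v
  ...   | yes refl = loopsStep (≈-trans p (≈-prep _ q))
          (rec E₂ (deg-opened u 0 q du (inc-≢ (u≢v ∘ ≡-sym) (u≢v ∘ ≡-sym))) (deg-opened v 2 q dv (inc-loop v)))
  ...   | no a≢v with noEdge-∷ {u} {v} none q
  ...     | m , none₂ with noEdge-≢′ u v a m | pull-deg v E₂ (subst (1 ≤_) (≡-sym (deg-opened v 1 q dv (inc-left a≢v))) (s≤s z≤n))
  ...       | a≢u | b , E₃ , r with b Fin.≟ v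
  -- The loop at `v` was found behind the edge `va`. The two loops are used up against each other
  -- and `va` returns to the list, to be matched later.
  ...         | yes refl = loopsStep (≈-trans p (≈-prep _ (≈-trans q (≈-pull r))))
                (rec ((v , a) ∷ E₃)
                  (trans (cong (_+ deg u E₃) (inc-≢ (u≢v ∘ ≡-sym) a≢u)) (deg-opened u 0 r du₂ (inc-≢ (u≢v ∘ ≡-sym) (u≢v ∘ ≡-sym))))
                  (deg-opened v 2 (≈-trans q (≈-pull r)) dv (inc-loop v)))
    where
    du₂ = deg-opened u 0 q du (inc-≢ (u≢v ∘ ≡-sym) a≢u)
  ...         | no b≢v = mixedStep u≢v a≢u a≢v b≢u b≢v (≈-trans p (≈-prep _ (≈-trans q (≈-prep _ r))))
                (rec E₃ (deg-opened u 0 r (deg-opened u 0 q du (inc-≢ (u≢v ∘ ≡-sym) a≢u)) (inc-≢ (u≢v ∘ ≡-sym) b≢u))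
                        (deg-opened v 1 r (deg-opened v 1 q dv (inc-left a≢v)) (inc-left b≢v)))
    where
    b≢u = noEdge-≢′ u v b (proj₁ (noEdge-∷ {u} {v} none₂ r))

  noEdge-comm : ∀ {u v} E → NoEdge u v E → NoEdge v u E
  noEdge-comm {u} {v} E h = trans (W-cong E (mul-comm v u)) h

  -- Recursion on the common number of half-edges. Edges between `u` and `v` are consumed first:
  -- once none is left, the other ends of non-loop edges at `u` or `v` lie outside the pair, so
  -- joining two of them creates no new edge at `u` or `v`. These ends may coincide; the new edge is
  -- then a loop.
  pairUp : ∀ k (E : List (Edge n)) {u v} → u ≢ v → deg u E ≡ k → deg v E ≡ k → PairReduction E u v
  pairUp zero E {u} {v} u≢v du dv = record
    { H = E
    ; gone = λ { z (inj₁ refl) → du ; z (inj₂ refl) → dv }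
    ; kept = λ _ _ → refl
    ; lift = λ cs → cs , (λ _ _ → refl) , trans (n≤0⇒n≡0 (subst (deg u (red cs) ≤_) du (W-red-≤ (inc u) cs)))
                                   (≡-sym (n≤0⇒n≡0 (subst (deg v (red cs) ≤_) dv (W-red-≤ (inc v) cs))))
    }
  pairUp (suc k) E {u} {v} u≢v du dv with W (mul u v) E in none
  ... | suc _ with pull-mul u v E (subst (1 ≤_) (≡-sym none) (s≤s z≤n))
  ...   | E₁ , p = parallelStep p (pairUp k E₁ u≢v
            (deg-opened u 1 p du (inc-left (u≢v ∘ ≡-sym))) (deg-opened v 1 p dv (inc-right u≢v)))
  pairUp (suc k) E {u} {v} u≢v du dv | zero with pull-deg u E (subst (1 ≤_) (≡-sym du) (s≤s z≤n))
  ... | a , E₁ , p with noEdge-∷ {u} {v} none p | a Fin.≟ u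
  pairUp (suc zero) E {u} {v} u≢v du dv | zero | a , E₁ , p | m , none₁ | yes refl
    with () ← trans (≡-sym du) (trans (deg-≈ u p) (cong (_+ deg u E₁) (inc-loop u)))
  pairUp (suc (suc k)) E {u} {v} u≢v du dv | zero | a , E₁ , p | m , none₁ | yes refl =
    loopAt k u≢v none₁ p (deg-opened u 2 p du (inc-loop u)) (deg-opened v 0 p dv (inc-≢ u≢v u≢v))
      (λ E₂ → pairUp k E₂ u≢v)
  pairUp (suc k) E {u} {v} u≢v du dv | zero | a , E₁ , p | m , none₁ | no a≢u
    with pull-deg v E₁ (subst (1 ≤_) (≡-sym (deg-opened v 0 p dv (inc-≢ u≢v (noEdge-≢ u v a m)))) (s≤s z≤n))
  ... | b , E₂ , q with b Fin.≟ v
  pairUp (suc zero) E {u} {v} u≢v du dv | zero | a , E₁ , p | m , none₁ | no a≢u | b , E₂ , q | yes refl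
    with () ← trans (≡-sym dv) (trans (deg-≈ v p) (trans (cong₂ _+_ (inc-≢ u≢v (noEdge-≢ u v a m)) (deg-≈ v q)) (cong (_+ deg v E₂) (inc-loop v))))
  pairUp (suc (suc k)) E {u} {v} u≢v du dv | zero | a , E₁ , p | m , none₁ | no a≢u | b , E₂ , q | yes refl =
    swapPair (loopAt k (u≢v ∘ ≡-sym) (noEdge-comm ((u , a) ∷ E₂) (proj₂ (noEdge-∷ {u} {v} none r))) r
      (deg-opened v 2 r dv (inc-loop v)) (deg-opened u 0 r du (inc-≢ (u≢v ∘ ≡-sym) (u≢v ∘ ≡-sym)))
      (λ E₃ d₁ d₂ → swapPair (pairUp k E₃ u≢v d₂ d₁)))
    where
    r = ≈-trans p (≈-pull q)
  ... | no b≢v = simpleStep u≢v a≢u (noEdge-≢ u v a m) b≢u b≢v (≈-trans p (≈-prep _ q))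
      (pairUp k E₂ u≢v (deg-opened u 0 q (deg-opened u 1 p du (inc-left a≢u)) (inc-≢ (u≢v ∘ ≡-sym) b≢u))
                       (deg-opened v 1 q (deg-opened v 0 p dv (inc-≢ u≢v (noEdge-≢ u v a m))) (inc-left b≢v)))
    where
    b≢u = noEdge-≢′ u v b (proj₁ (noEdge-∷ {u} {v} none₁ q))

  suppress : ∀ (E : List (Edge n)) v → deg v E ≡ 2 →
             Reduction E (_≡ v) (λ d → Σ Bool λ c → d v ≡ bit c + bit c)
  suppress E v dv with pull-deg v E (subst (1 ≤_) (≡-sym dv) (s≤s z≤n))
  ... | a , E₁ , p with a Fin.≟ v
  -- If the two half-edges at `v` form a loop there is nothing to join: the loop disappears and is
  -- coloured blue.
  ...   | yes refl = record
    { H = E₁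
    ; gone = λ { z refl → dv₁ }
    ; kept = λ z z≢v → ≡-sym (trans (deg-≈ z p) (cong (_+ deg z E₁) (inc-≢ (z≢v ∘ ≡-sym) (z≢v ∘ ≡-sym))))
    ; lift = λ cs → let cs′ , r = recolour (≈-sym p) (false ∷ cs) in
        cs′ , (λ z _ → ≡-sym (deg-≈ z r)) , false ,
        trans (≡-sym (deg-≈ v r)) (n≤0⇒n≡0 (subst (deg v (red cs) ≤_) dv₁ (W-red-≤ (inc v) cs)))
    }
    where
    dv₁ = deg-opened v 2 p dv (inc-loop v)
  ...   | no a≢v with pull-deg v E₁ (subst (1 ≤_) (≡-sym (deg-opened v 1 p dv (inc-left a≢v))) (s≤s z≤n))
  ...     | b , E₂ , q with b Fin.≟ v
  ...       | yes refl with () ← trans (≡-sym (deg-opened v 1 p dv (inc-left a≢v))) (trans (deg-≈ v q) (cong (_+ deg v E₂) (inc-loop v)))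
  ...       | no b≢v = record
    { H = (a , b) ∷ E₂
    ; gone = λ { z refl → cong₂ _+_ (inc-≢ a≢v b≢v) dv₂ }
    ; kept = λ z z≢v → ≡-sym (trans (deg-≈ z r) (same E₂ z≢v))
    ; lift = λ { (c ∷ cs) → let cs′ , s = recolour (≈-sym r) (c ∷ c ∷ cs) in
        cs′ , (λ z z≢v → trans (≡-sym (deg-≈ z s)) (same-red c cs z≢v)) , c , trans (≡-sym (deg-≈ v s)) (at-v c cs) }
    }
    where
    r : E ≈ (v , a) ∷ (v , b) ∷ E₂
    r = ≈-trans p (≈-prep _ q)
    dv₂ : deg v E₂ ≡ 0
    dv₂ = deg-opened v 1 q (deg-opened v 1 p dv (inc-left a≢v)) (inc-left b≢v)
    same : ∀ L {z} → z ≢ v → deg z ((v , a) ∷ (v , b) ∷ L) ≡ deg z ((a , b) ∷ L)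
    same L {z} z≢v = trans (cong₂ _+_ (inc-other {a = a} (z≢v ∘ ≡-sym)) (cong (_+ deg z L) (inc-other {a = b} (z≢v ∘ ≡-sym))))
                       (≡-sym (+-assoc (δ a z) (δ b z) (deg z L)))
    same-red : ∀ c (cs : Colouring E₂) {z} → z ≢ v →
               deg z (red {E = (v , a) ∷ (v , b) ∷ E₂} (c ∷ c ∷ cs)) ≡ deg z (red {E = (a , b) ∷ E₂} (c ∷ cs))
    same-red true  cs = same (red cs)
    same-red false cs _ = refl
    none : ∀ (cs : Colouring E₂) → deg v (red cs) ≡ 0
    none cs = n≤0⇒n≡0 (subst (deg v (red cs) ≤_) dv₂ (W-red-≤ (inc v) cs))
    at-v : ∀ c (cs : Colouring E₂) → deg v (red {E = (v , a) ∷ (v , b) ∷ E₂} (c ∷ c ∷ cs)) ≡ bit c + bit c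
    at-v true  cs = cong₂ _+_ (inc-left a≢v) (cong₂ _+_ (inc-left b≢v) (none cs))
    at-v false cs = none cs

legal? : ∀ d → Dec (Legal d)
legal? d = (d ≟ 4) ⊎-dec (d ≟ 1)

-- A vertex that is isolated in `E` may be declared gone although the reduction never touched it.
-- This serves configurations that contain all the edges at some of their vertices.
convert : ∀ {n} {E : List (Edge n)} {G G′ : Fin n → Set} {Q Q′ : (Fin n → ℕ) → Set} → Reduction E G Q →
          (∀ z → G z → G′ z) → (∀ z → G′ z → G z ⊎ ¬ G z × deg z E ≡ 0) →
          (∀ d → (∀ z → d z ≤ deg z E) → Q d → Q′ d) → Reduction E G′ Q′
convert R to from q = record
  { H    = H
  ; gone = λ z g → [ gone z , (λ (¬g , d) → trans (kept z ¬g) d) ]′ (from z g)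
  ; kept = λ z ¬g → kept z (¬g ∘ to z)
  ; lift = λ cs → let cs′ , k , x = lift cs in
      cs′ , (λ z ¬g → k z (¬g ∘ to z)) , q _ (λ z → W-red-≤ (inc z) cs′) x
  }
  where open Reduction R

-- Lifting through `R` settles the red degrees on `G` and leaves the others alone. Hence `Q′` is
-- known only for the intermediate degrees `d′`, which agree with the final ones off `G`.
compose : ∀ {n} {E : List (Edge n)} {G G′ : Fin n → Set} {Q Q′ : (Fin n → ℕ) → Set}
          (R : Reduction E G Q) → Reduction (Reduction.H R) G′ Q′ → (∀ z → G z → ¬ G′ z) →
          Reduction E (λ z → G z ⊎ G′ z) (λ d → Q d × ∃ λ d′ → (∀ z → ¬ G z → d z ≡ d′ z) × Q′ d′)
compose R R′ disjoint = record
  { H    = R′.H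
  ; gone = λ z → [ (λ g → trans (R′.kept z (disjoint z g)) (R.gone z g)) , R′.gone z ]′
  ; kept = λ z ¬g → trans (R′.kept z (¬g ∘ inj₂)) (R.kept z (¬g ∘ inj₁))
  ; lift = λ cs → let cs₁ , k₁ , q₁ = R′.lift cs ; cs₂ , k₂ , q₂ = R.lift cs₁ in
      cs₂ , (λ z ¬g → trans (k₂ z (¬g ∘ inj₁)) (k₁ z (¬g ∘ inj₂))) , q₂ , (λ z → deg z (red cs₁)) , k₂ , q₁
  }
  where
  module R  = Reduction R
  module R′ = Reduction R′

false≢true : ¬ false ≡ true
false≢true ()

Σ-1 : ∀ n → Σ-fin {n} (λ _ → 1) ≡ n
Σ-1 zero    = refl
Σ-1 (suc n) = trans (Σ-suc {n} (λ _ → 1)) (cong suc (Σ-1 n))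

count< : ∀ {n} (A : Fin n → Bool) a → A a ≡ false → count A < n
count< {n} A a Aa = begin
  suc (count A)                  ≡⟨ +-comm 1 _ ⟩
  count A + 1                    ≡⟨ cong (count A +_) (≡-sym (Σ-δ₁ a)) ⟩
  count A + Σ-fin (δ a)          ≡⟨ ≡-sym (Σ-+ (bit ∘ A) (δ a)) ⟩
  Σ-fin (λ v → bit (A v) + δ a v) ≤⟨ Σ-mono le ⟩
  Σ-fin {n} (λ _ → 1)            ≡⟨ Σ-1 n ⟩
  n ∎
  where
  open ≤-Reasoning
  le : ∀ v → bit (A v) + δ a v ≤ 1
  le v with a Fin.≟ v
  ... | yes refl rewrite Aa = ≤-refl
  ... | no _ with A v
  ...   | true  = ≤-refl
  ...   | false = z≤n

Image : ∀ {k n} → (Fin k → Fin n) → Fin n → Set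
Image f z = ∃ λ i → f i ≡ z

deg-map-∉ : ∀ {k n} (f : Fin k → Fin n) {z} → ¬ Image f z → ∀ K → deg z (mapᴱ f K) ≡ 0
deg-map-∉ f ¬im [] = refl
deg-map-∉ f ¬im ((i , j) ∷ K) = cong₂ _+_ (inc-≢ (λ p → ¬im (i , p)) (λ p → ¬im (j , p))) (deg-map-∉ f ¬im K)

Completable : ∀ {k n} → (Fin k → Fin n) → List (Edge k) → (Fin n → ℕ) → Set
Completable f K d = Σ (Colouring K) λ ks → ∀ i → Legal (deg i (red ks) + d (f i))

-- Reducible configurations: K4, parallel edges, adjacent loops and the looped K3,3

module Reducible {N : ℕ} (E : List (Edge N)) (regular : ∀ v → deg v E ≡ 5) (minimal : Minimal N)
                 (noFactor : ¬ FactorOn (λ _ → true) E) where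

  -- The common frame of the four exclusions. The factor of the reduced graph lifts to the edges
  -- left after deleting the copy of `K`, and `Completable` colours that copy to suit the red
  -- degrees already present. The domain `Fin (suc k)` ensures that at least one vertex is lost.
  reducible : ∀ {k} {f : Fin (suc k) → Fin N} → Injective _≡_ _≡_ f → (K : List (Edge (suc k))) →
    All (λ (i , j) → W (mul i j) K ≤ W (mul (f i) (f j)) E) K →
    (∀ E′ → (∀ i → deg i K + deg (f i) E′ ≡ 5) → Reduction E′ (Image f) (Completable f K)) → ⊥
  reducible {k} {f} inj K K≤E reduce with pull-all (mapᴱ f K) E (onImage K K≤E)
    where
    onImage : ∀ L → All (λ (i , j) → W (mul i j) K ≤ W (mul (f i) (f j)) E) L →
              All (λ (a , b) → W (mul a b) (mapᴱ f K) ≤ W (mul a b) E) (mapᴱ f L)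
    onImage [] [] = []
    onImage ((i , j) ∷ L) (h ∷ hs) = subst (_≤ _) (≡-sym (mul-mapᴱ inj i j K)) h ∷ onImage L hs
  ... | E′ , p = noFactor (proj₁ whole , legal)
    where
    degE : ∀ v → deg v (mapᴱ f K) + deg v E′ ≡ 5
    degE v = trans (≡-sym (W-++ (inc v) (mapᴱ f K) E′)) (trans (≡-sym (deg-≈ v p)) (regular v))
    open Reduction (reduce E′ (λ i → trans (cong (_+ _) (≡-sym (deg-map inj i K))) (degE (f i))))
    im? : ∀ z → Dec (Image f z)
    im? z = Finₚ.any? (λ i → f i Fin.≟ z)
    A : Fin N → Bool
    A z = not (does (im? z))
    dead : A (f zero) ≡ false
    dead = cong not (dec-true (im? (f zero)) (zero , refl))
    deg5 : ∀ z → ¬ Image f z → deg z H ≡ 5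
    deg5 z ¬i = trans (kept z ¬i) (trans (cong (_+ deg z E′) (≡-sym (deg-map-∉ f ¬i K))) (degE z))
    small : FactorOn A H
    small = factorOnSmaller minimal A (count< A (f zero) dead) H (r₁ , r₂)
      where
      r₁ : ∀ v → A v ≡ true → deg v H ≡ 5
      r₁ v h = deg5 v λ i → false≢true (trans (≡-sym (cong not (dec-true (im? v) i))) h)
      r₂ : ∀ v → A v ≡ false → deg v H ≡ 0
      r₂ v h = [ gone v , (λ ¬i → ⊥-elim (false≢true (trans (≡-sym h) (cong not (dec-false (im? v) ¬i))))) ]′ (toSum (im? v))
    cs′ = proj₁ (lift (proj₁ small))
    ks : Colouring K
    ks = proj₁ (proj₂ (proj₂ (lift (proj₁ small))))
    whole = recolour (≈-sym p) (mapᶜ f ks ++ᶜ cs′)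
    at : ∀ z → deg z (red (proj₁ whole)) ≡ deg z (mapᴱ f (red ks)) + deg z (red cs′)
    at z = trans (≡-sym (deg-≈ z (proj₂ whole))) (trans (W-red-++ (inc z) (mapᶜ f ks) cs′)
             (cong (λ L → deg z L + deg z (red cs′)) (red-mapᶜ f ks)))
    legal : ∀ v → true ≡ true → Legal (deg v (red (proj₁ whole)))
    legal v _ with im? v
    ... | yes (i , refl) = subst Legal (≡-sym (trans (at (f i)) (cong (_+ deg (f i) (red cs′)) (deg-map inj i (red ks)))))
                             (proj₂ (proj₂ (proj₂ (lift (proj₁ small)))) i)
    ... | no ¬i = subst Legal (≡-sym (trans (at v) (trans (cong (_+ deg v (red cs′)) (deg-map-∉ f ¬i (red ks)))
                     (proj₁ (proj₂ (lift (proj₁ small))) v ¬i)))) (proj₂ small v (cong not (dec-false (im? v) ¬i)))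

  pairOf : Fin N → Fin N → Fin 2 → Fin N
  pairOf u v 0F = u
  pairOf u v 1F = v

  pairOf-inj : ∀ {u v} → u ≢ v → Injective _≡_ _≡_ (pairOf u v)
  pairOf-inj u≢v {0F} {0F} _ = refl
  pairOf-inj u≢v {0F} {1F} p = contradiction p u≢v
  pairOf-inj u≢v {1F} {0F} p = contradiction (≡-sym p) u≢v
  pairOf-inj u≢v {1F} {1F} _ = refl

  -- Each of the two vertices has `k` half-edges outside `K`, and `pairUp` makes the same number `j`
  -- of them red at both. A table with one row for each `j ≤ k` therefore covers all cases.
  pairReducible : ∀ {u v} → u ≢ v → ∀ (K : List (Edge 2)) k → k + deg 0F K ≡ 5 → k + deg 1F K ≡ 5 →
    All (λ (i , j) → W (mul i j) K ≤ W (mul (pairOf u v i) (pairOf u v j)) E) K →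
    (∀ j → j ≤ k → Σ (Colouring K) λ ks → ∀ i → Legal (deg i (red ks) + j)) → ⊥
  pairReducible {u} {v} u≢v K k h₀ h₁ K≤E table = reducible (pairOf-inj u≢v) K K≤E λ E′ d →
    convert (pairUp k E′ u≢v (remaining 0F E′ (d 0F) h₀) (remaining 1F E′ (d 1F) h₁))
      (λ { z (inj₁ refl) → 0F , refl ; z (inj₂ refl) → 1F , refl })
      (λ { z (0F , refl) → inj₁ (inj₁ refl) ; z (1F , refl) → inj₁ (inj₂ refl) })
      (λ dd bound same → let ks , ok = table (dd u) (subst (dd u ≤_) (remaining 0F E′ (d 0F) h₀) (bound u)) in
        ks , λ { 0F → ok 0F ; 1F → subst (λ x → Legal (deg 1F (red ks) + x)) same (ok 1F) })
    where
    remaining : ∀ i E′ → deg i K + deg (pairOf u v i) E′ ≡ 5 → k + deg i K ≡ 5 → deg (pairOf u v i) E′ ≡ k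
    remaining i E′ p q = +-cancelˡ-≡ (deg i K) _ _ (trans p (trans (≡-sym q) (+-comm k _)))

  noParallel : ∀ {u v} → u ≢ v → ¬ 2 ≤ W (mul u v) E
  noParallel u≢v h = pairReducible u≢v K 3 refl refl (h ∷ h ∷ []) table
    where
    K : List (Edge 2)
    K = (0F , 1F) ∷ (0F , 1F) ∷ []
    table : ∀ j → j ≤ 3 → Σ (Colouring K) λ ks → ∀ i → Legal (deg i (red ks) + j)
    table 0 _ = true ∷ false ∷ [] , λ { 0F → inj₂ refl ; 1F → inj₂ refl }
    table 1 _ = false ∷ false ∷ [] , λ { 0F → inj₂ refl ; 1F → inj₂ refl }
    table 2 _ = true ∷ true ∷ [] , λ { 0F → inj₁ refl ; 1F → inj₁ refl }
    table 3 _ = true ∷ false ∷ [] , λ { 0F → inj₁ refl ; 1F → inj₁ refl }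
    table (suc (suc (suc (suc _)))) (s≤s (s≤s (s≤s ())))

  noAdjacentLoops : ∀ {u v} → u ≢ v → 1 ≤ W (mul u u) E → 1 ≤ W (mul v v) E → ¬ 1 ≤ W (mul u v) E
  noAdjacentLoops u≢v hu hv h = pairReducible u≢v K 2 refl refl (hu ∷ hv ∷ h ∷ []) table
    where
    K : List (Edge 2)
    K = (0F , 0F) ∷ (1F , 1F) ∷ (0F , 1F) ∷ []
    table : ∀ j → j ≤ 2 → Σ (Colouring K) λ ks → ∀ i → Legal (deg i (red ks) + j)
    table 0 _ = false ∷ false ∷ true ∷ [] , λ { 0F → inj₂ refl ; 1F → inj₂ refl }
    table 1 _ = false ∷ false ∷ false ∷ [] , λ { 0F → inj₂ refl ; 1F → inj₂ refl }
    table 2 _ = true ∷ true ∷ false ∷ [] , λ { 0F → inj₁ refl ; 1F → inj₁ refl }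
    table (suc (suc (suc _))) (s≤s (s≤s ()))

  -- Each vertex of the K4 keeps two half-edges. Applying `pairUp` to 0, 1 and then to 2, 3 leaves
  -- two parameters, the red numbers `j` and `k` of the two pairs, hence nine cases.
  noK4 : (f : Fin 4 → Fin N) → Injective _≡_ _≡_ f → ¬ (∀ a b → a ≢ b → 1 ≤ W (mul (f a) (f b)) E)
  noK4 f inj adjacent = reducible inj K
    (adjacent 0F 1F (λ ()) ∷ adjacent 2F 3F (λ ()) ∷ adjacent 0F 2F (λ ()) ∷ adjacent 1F 3F (λ ()) ∷
     adjacent 0F 3F (λ ()) ∷ adjacent 1F 2F (λ ()) ∷ []) reduce
    where
    K : List (Edge 4)
    K = (0F , 1F) ∷ (2F , 3F) ∷ (0F , 2F) ∷ (1F , 3F) ∷ (0F , 3F) ∷ (1F , 2F) ∷ []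
    halves : ℕ → ℕ → Fin 4 → ℕ
    halves j k 0F = j
    halves j k 1F = j
    halves j k 2F = k
    halves j k 3F = k
    Table : ℕ → ℕ → Set
    Table j k = Σ (Colouring K) λ ks → ∀ i → Legal (deg i (red ks) + halves j k i)
    check : ∀ j k (ks : Colouring K) {_ : True (Finₚ.all? λ i → legal? (deg i (red ks) + halves j k i))} → Table j k
    check j k ks {ok} = ks , toWitness ok
    -- The matching 02, 13 is monochromatic, and so is 03, 12; together they give all four vertices
    -- the same number m of red edges, between 0 and 2. The edges 01 and 23 then bring j + m and k +
    -- m separately to 1 or 4.
    table : ∀ j k → j ≤ 2 → k ≤ 2 → Table j k
    table 0 0 _ _ = check 0 0 (true ∷ true ∷ false ∷ false ∷ false ∷ false ∷ [])
    table 0 1 _ _ = check 0 1 (true ∷ false ∷ false ∷ false ∷ false ∷ false ∷ [])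
    table 0 2 _ _ = check 0 2 (false ∷ true ∷ true ∷ true ∷ false ∷ false ∷ [])
    table 1 0 _ _ = check 1 0 (false ∷ true ∷ false ∷ false ∷ false ∷ false ∷ [])
    table 1 1 _ _ = check 1 1 (false ∷ false ∷ false ∷ false ∷ false ∷ false ∷ [])
    table 1 2 _ _ = check 1 2 (true ∷ false ∷ true ∷ true ∷ true ∷ true ∷ [])
    table 2 0 _ _ = check 2 0 (true ∷ false ∷ true ∷ true ∷ false ∷ false ∷ [])
    table 2 1 _ _ = check 2 1 (false ∷ true ∷ true ∷ true ∷ true ∷ true ∷ [])
    table 2 2 _ _ = check 2 2 (false ∷ false ∷ true ∷ true ∷ true ∷ true ∷ [])
    table (suc (suc (suc _))) _ (s≤s (s≤s ())) _
    table _ (suc (suc (suc _))) _ (s≤s (s≤s ()))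
    ≢ᶠ : ∀ {i j} → i ≢ j → f i ≢ f j
    ≢ᶠ i≢j p = i≢j (inj p)
    reduce : ∀ E′ → (∀ i → deg i K + deg (f i) E′ ≡ 5) → Reduction E′ (Image f) (Completable f K)
    reduce E′ d = convert (compose R₁ R₂ disjoint)
      (λ { z (inj₁ (inj₁ refl)) → 0F , refl ; z (inj₁ (inj₂ refl)) → 1F , refl
         ; z (inj₂ (inj₁ refl)) → 2F , refl ; z (inj₂ (inj₂ refl)) → 3F , refl })
      (λ { z (0F , refl) → inj₁ (inj₁ (inj₁ refl)) ; z (1F , refl) → inj₁ (inj₁ (inj₂ refl))
         ; z (2F , refl) → inj₁ (inj₂ (inj₁ refl)) ; z (3F , refl) → inj₁ (inj₂ (inj₂ refl)) })
      complete
      where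
      e : ∀ i → deg i K ≡ 3 → deg (f i) E′ ≡ 2
      e i q = +-cancelˡ-≡ 3 _ _ (trans (cong (_+ deg (f i) E′) (≡-sym q)) (d i))
      R₁ : PairReduction E′ (f 0F) (f 1F)
      R₁ = pairUp 2 E′ (≢ᶠ λ ()) (e 0F refl) (e 1F refl)
      ¬2 : ¬ Two (f 0F) (f 1F) (f 2F)
      ¬2 = [ (≢ᶠ λ ()) , (≢ᶠ λ ()) ]′
      ¬3 : ¬ Two (f 0F) (f 1F) (f 3F)
      ¬3 = [ (≢ᶠ λ ()) , (≢ᶠ λ ()) ]′
      R₂ : PairReduction (Reduction.H R₁) (f 2F) (f 3F)
      R₂ = pairUp 2 (Reduction.H R₁) (≢ᶠ λ ()) (trans (Reduction.kept R₁ (f 2F) ¬2) (e 2F refl))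
                                           (trans (Reduction.kept R₁ (f 3F) ¬3) (e 3F refl))
      disjoint : ∀ z → Two (f 0F) (f 1F) z → ¬ Two (f 2F) (f 3F) z
      disjoint z g (inj₁ refl) = ¬2 g
      disjoint z g (inj₂ refl) = ¬3 g
      complete : ∀ dd → (∀ z → dd z ≤ deg z E′) →
        SameDegree (f 0F) (f 1F) dd × (∃ λ d′ → (∀ z → ¬ Two (f 0F) (f 1F) z → dd z ≡ d′ z) × SameDegree (f 2F) (f 3F) d′) →
        Completable f K dd
      complete dd bound (same , d′ , eq , same′)
        with table (dd (f 0F)) (dd (f 2F)) (subst (_ ≤_) (e 0F refl) (bound (f 0F))) (subst (_ ≤_) (e 2F refl) (bound (f 2F)))
      ... | ks , ok = ks , λ { 0F → ok 0F ; 1F → subst (λ x → Legal (deg 1F (red ks) + x)) same (ok 1F) ; 2F → ok 2F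
                             ; 3F → subst (λ x → Legal (deg 3F (red ks) + x)) same₃ (ok 3F) }
        where
        same₃ : dd (f 2F) ≡ dd (f 3F)
        same₃ = trans (eq (f 2F) ¬2) (trans same′ (≡-sym (eq (f 3F) ¬3)))

  -- Every `us i` spends its whole degree 2 + 3 on the configuration, and every `vs j` keeps two
  -- half-edges. Three vertices cannot be split into pairs, so each `vs j` is treated by `suppress`;
  -- the Booleans `p`, `q`, `r` record whether its two half-edges are red.
  noK33 : (us vs : Fin 3 → Fin N) → Injective _≡_ _≡_ us → Injective _≡_ _≡_ vs → (∀ i j → us i ≢ vs j) →
          (∀ i → 1 ≤ W (mul (us i) (us i)) E) → ¬ (∀ i j → 1 ≤ W (mul (us i) (vs j)) E)
  noK33 us vs us-inj vs-inj us≢vs loop adjacent = reducible f-inj K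
    (loop 0F ∷ loop 1F ∷ loop 2F ∷ adjacent 0F 0F ∷ adjacent 0F 1F ∷ adjacent 0F 2F ∷
     adjacent 1F 0F ∷ adjacent 1F 1F ∷ adjacent 1F 2F ∷ adjacent 2F 0F ∷ adjacent 2F 1F ∷ adjacent 2F 2F ∷ []) reduce
    where
    K : List (Edge 6)
    K = (0F , 0F) ∷ (1F , 1F) ∷ (2F , 2F) ∷ (0F , 3F) ∷ (0F , 4F) ∷ (0F , 5F) ∷
        (1F , 3F) ∷ (1F , 4F) ∷ (1F , 5F) ∷ (2F , 3F) ∷ (2F , 4F) ∷ (2F , 5F) ∷ []
    f : Fin 6 → Fin N
    f i = [ us , vs ]′ (splitAt 3 i)
    f-inj : Injective _≡_ _≡_ f
    f-inj {i} {j} p = trans (≡-sym (Finₚ.join-splitAt 3 3 i))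
                        (trans (cong (join 3 3) (cases (splitAt 3 i) (splitAt 3 j) p)) (Finₚ.join-splitAt 3 3 j))
      where
      cases : ∀ x y → [ us , vs ]′ x ≡ [ us , vs ]′ y → x ≡ y
      cases (inj₁ a) (inj₁ b) q = cong inj₁ (us-inj q)
      cases (inj₁ a) (inj₂ b) q = contradiction q (us≢vs a b)
      cases (inj₂ a) (inj₁ b) q = contradiction (≡-sym q) (us≢vs b a)
      cases (inj₂ a) (inj₂ b) q = cong inj₂ (vs-inj q)
    rest : Bool → Bool → Bool → Fin 6 → ℕ
    rest p q r 3F = bit p + bit p
    rest p q r 4F = bit q + bit q
    rest p q r 5F = bit r + bit r
    rest p q r _  = 0
    -- Red: the matching u_i v_i and, at each v_j whose two other edges are red, one further edge v_j u_{j+1}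
    -- together with the loop at u_{j+1}.
    ks : Bool → Bool → Bool → Colouring K
    ks p q r = r ∷ p ∷ q ∷ true ∷ false ∷ r ∷ p ∷ true ∷ false ∷ false ∷ q ∷ true ∷ []
    legal : ∀ p q r i → Legal (deg i (red (ks p q r)) + rest p q r i)
    legal true  true  true  = from-yes (Finₚ.all? λ i → legal? (deg i (red (ks true true true)) + rest true true true i))
    legal true  true  false = from-yes (Finₚ.all? λ i → legal? (deg i (red (ks true true false)) + rest true true false i))
    legal true  false true  = from-yes (Finₚ.all? λ i → legal? (deg i (red (ks true false true)) + rest true false true i))
    legal true  false false = from-yes (Finₚ.all? λ i → legal? (deg i (red (ks true false false)) + rest true false false i))
    legal false true  true  = from-yes (Finₚ.all? λ i → legal? (deg i (red (ks false true true)) + rest false true true i))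
    legal false true  false = from-yes (Finₚ.all? λ i → legal? (deg i (red (ks false true false)) + rest false true false i))
    legal false false true  = from-yes (Finₚ.all? λ i → legal? (deg i (red (ks false false true)) + rest false false true i))
    legal false false false = from-yes (Finₚ.all? λ i → legal? (deg i (red (ks false false false)) + rest false false false i))
    reduce : ∀ E′ → (∀ i → deg i K + deg (f i) E′ ≡ 5) → Reduction E′ (Image f) (Completable f K)
    reduce E′ d = convert (compose (compose R₀ R₁ disj₁) R₂ disj₂)
      (λ { z (inj₁ (inj₁ refl)) → 3F , refl ; z (inj₁ (inj₂ refl)) → 4F , refl ; z (inj₂ refl) → 5F , refl })
      (λ { z (0F , refl) → inj₂ (u∉ 0F , u0 0F refl) ; z (1F , refl) → inj₂ (u∉ 1F , u0 1F refl) ; z (2F , refl) → inj₂ (u∉ 2F , u0 2F refl)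
         ; z (3F , refl) → inj₁ (inj₁ (inj₁ refl)) ; z (4F , refl) → inj₁ (inj₁ (inj₂ refl)) ; z (5F , refl) → inj₁ (inj₂ refl) })
      (λ { dd bound ((((p , pp) , d₁ , eq₁ , q , qq) , d₂ , eq₂ , r , rr)) →
           ks p q r , λ i → subst (λ x → Legal (deg i (red (ks p q r)) + x))
             (≡-sym (restOf dd bound p q r pp (trans (eq₁ _ 1≢0) qq) (trans (eq₂ _ 2∉) rr) i)) (legal p q r i) })
      where
      1≢0 : vs 1F ≢ vs 0F
      1≢0 h with () ← vs-inj h
      2∉ : ¬ (vs 2F ≡ vs 0F ⊎ vs 2F ≡ vs 1F)
      2∉ (inj₁ h) with () ← vs-inj h
      2∉ (inj₂ h) with () ← vs-inj h
      u∉ : ∀ i → ¬ ((us i ≡ vs 0F ⊎ us i ≡ vs 1F) ⊎ us i ≡ vs 2F)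
      u∉ i (inj₁ (inj₁ h)) = us≢vs i 0F h
      u∉ i (inj₁ (inj₂ h)) = us≢vs i 1F h
      u∉ i (inj₂ h)        = us≢vs i 2F h
      u0 : ∀ i → deg i K ≡ 5 → deg (f i) E′ ≡ 0
      u0 i h = +-cancelˡ-≡ 5 _ _ (trans (cong (_+ deg (f i) E′) (≡-sym h)) (d i))
      v2 : ∀ i → deg i K ≡ 3 → deg (f i) E′ ≡ 2
      v2 i h = +-cancelˡ-≡ 3 _ _ (trans (cong (_+ deg (f i) E′) (≡-sym h)) (d i))
      R₀ = suppress E′ (vs 0F) (v2 3F refl)
      R₁ = suppress (Reduction.H R₀) (vs 1F) (trans (Reduction.kept R₀ (vs 1F) 1≢0) (v2 4F refl))
      disj₁ : ∀ z → z ≡ vs 0F → z ≢ vs 1F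
      disj₁ z refl h = 1≢0 (≡-sym h)
      R₀₁ = compose R₀ R₁ disj₁
      R₂ = suppress (Reduction.H R₀₁) (vs 2F) (trans (Reduction.kept R₀₁ (vs 2F) 2∉) (v2 5F refl))
      disj₂ : ∀ z → z ≡ vs 0F ⊎ z ≡ vs 1F → z ≢ vs 2F
      disj₂ z h refl = 2∉ h
      restOf : ∀ dd → (∀ z → dd z ≤ deg z E′) → ∀ p q r → dd (vs 0F) ≡ bit p + bit p → dd (vs 1F) ≡ bit q + bit q →
               dd (vs 2F) ≡ bit r + bit r → ∀ i → dd (f i) ≡ rest p q r i
      restOf dd bound p q r pp qq rr 0F = n≤0⇒n≡0 (subst (dd (us 0F) ≤_) (u0 0F refl) (bound _))
      restOf dd bound p q r pp qq rr 1F = n≤0⇒n≡0 (subst (dd (us 1F) ≤_) (u0 1F refl) (bound _))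
      restOf dd bound p q r pp qq rr 2F = n≤0⇒n≡0 (subst (dd (us 2F) ≤_) (u0 2F refl) (bound _))
      restOf dd bound p q r pp qq rr 3F = pp
      restOf dd bound p q r pp qq rr 4F = qq
      restOf dd bound p q r pp qq rr 5F = rr

-- Matchings and barriers

does⇒ : ∀ {P : Set} (P? : Dec P) → does P? ≡ true → P
does⇒ (yes p) _ = p

-- Double-negation shift over a finite type: excluded middle can be assumed for all pairs of
-- vertices at once.
¬¬-∀Fin : ∀ {n} {P : Fin n → Set} → (∀ i → ¬ ¬ P i) → ¬ ¬ (∀ i → P i)
¬¬-∀Fin {zero}  h k = k λ ()
¬¬-∀Fin {suc n} h k = h zero λ p₀ → ¬¬-∀Fin (h ∘ suc) λ ps → k λ { zero → p₀ ; (suc i) → ps i }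

≤1∧≢0⇒≡1 : ∀ {m} → m ≤ 1 → m ≢ 0 → m ≡ 1
≤1∧≢0⇒≡1 {zero}  _ h = contradiction refl h
≤1∧≢0⇒≡1 {suc zero} _ _ = refl
≤1∧≢0⇒≡1 {suc (suc _)} (s≤s ()) _

bit≤1 : ∀ b → bit b ≤ 1
bit≤1 true  = ≤-refl
bit≤1 false = z≤n

bit-true : ∀ {b} → 1 ≤ bit b → b ≡ true
bit-true {true} _ = refl

without : ∀ {n} → (Fin n → Bool) → Fin n → Fin n → Bool
without A v z = A z ∧ not (does (v Fin.≟ z))

without-≡ : ∀ {n} (A : Fin n → Bool) v → without A v v ≡ false
without-≡ A v rewrite dec-true (v Fin.≟ v) refl = Boolₚ.∧-zeroʳ (A v)

without-≢ : ∀ {n} (A : Fin n → Bool) {v z} → v ≢ z → without A v z ≡ A z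
without-≢ A {v} {z} v≢z rewrite dec-false (v Fin.≟ z) v≢z = Boolₚ.∧-identityʳ (A z)

without-⊆ : ∀ {n} (A : Fin n → Bool) v {z} → without A v z ≡ true → A z ≡ true × v ≢ z
without-⊆ A v {z} h with A z | v Fin.≟ z
... | true | no v≢z = refl , v≢z

count-without : ∀ {n} (A : Fin n → Bool) v → A v ≡ true → count A ≡ suc (count (without A v))
count-without A v Av = trans (Σ-cong split) (trans (Σ-+ (δ v) (bit ∘ without A v)) (cong (_+ count (without A v)) (Σ-δ₁ v)))
  where
  split : ∀ z → bit (A z) ≡ δ v z + bit (without A v z)
  split z with v Fin.≟ z
  ... | yes refl rewrite Av = refl
  ... | no _     rewrite Boolₚ.∧-identityʳ (A z) = refl

size : ∀ {n} → List (Edge n) → ℕ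
size = W (λ _ → 1)

Σ-deg : ∀ {n} (M : List (Edge n)) → Σ-fin (λ v → deg v M) ≡ size M + size M
Σ-deg M = trans (Σ-cong (λ v → ≡-sym (+-identityʳ (deg v M))))
  (trans (handshake (λ _ → 1) M) (W-+ (λ _ → 1) (λ _ → 1) M))

module _ {N : ℕ} (I : List (Edge N)) where

  Adj : Edge N → Set
  Adj (a , b) = 1 ≤ W (mul a b) I

  Adj-flip : ∀ a b → Adj (a , b) → Adj (b , a)
  Adj-flip a b = subst (1 ≤_) (W-cong I (mul-comm a b))

  -- The single degree bound says that the edges lie in `A`, that they are pairwise disjoint, and
  -- that none is a loop, which would have degree 2.
  Matching : (Fin N → Bool) → List (Edge N) → Set
  Matching A M = All Adj M × (∀ v → deg v M ≤ bit (A v))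

  Matching-≈ : ∀ {A M M′} → M ≈ M′ → Matching A M → Matching A M′
  Matching-≈ {A} p (adj , d) = All-≈ Adj-flip p adj , λ v → subst (_≤ bit (A v)) (deg-≈ v p) (d v)

  -- S is the Tutte set; the odd pieces of A − S are the sets C r for the representatives r in R.
  -- They need not be connected, only closed under adjacency within A − S.
  record Barrier (A : Fin N → Bool) : Set where
    field
      S R : Fin N → Bool
      C   : Fin N → Fin N → Bool
      C⊆A : ∀ {r v} → R r ≡ true → C r v ≡ true → A v ≡ true
      C∩S : ∀ {r v} → R r ≡ true → C r v ≡ true → S v ≡ false
      C-disjoint : ∀ {r r′ v} → R r ≡ true → R r′ ≡ true → C r v ≡ true → C r′ v ≡ true → r ≡ r′
      C-closed : ∀ {r a b} → R r ≡ true → C r a ≡ true → Adj (a , b) → A b ≡ true → S b ≡ false → C r b ≡ true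
      C-odd : ∀ {r} → R r ≡ true → ∃ λ h → count (C r) ≡ suc (h + h)

  -- Gallai's lemma

  module Gallai (A : Fin N → Bool) (ν : ℕ) (max : ∀ M → Matching A M → size M ≤ ν) where

    -- By `max`, a matching of size `ν` is maximum. The diagonal case `MissBoth v v` says that some
    -- maximum matching misses `v`.
    MissBoth : Fin N → Fin N → Set
    MissBoth u v = ∃ λ M → Matching A M × size M ≡ ν × deg u M ≡ 0 × deg v M ≡ 0

    addEdge : ∀ {x y M} → x ≢ y → Adj (x , y) → A x ≡ true → A y ≡ true → deg x M ≡ 0 → deg y M ≡ 0 →
              Matching A M → Matching A ((x , y) ∷ M)
    addEdge {x} {y} {M} x≢y xy Ax Ay dx dy (adj , d) = xy ∷ adj , le
      where
      le : ∀ z → deg z ((x , y) ∷ M) ≤ bit (A z)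
      le z with z Fin.≟ x | z Fin.≟ y
      ... | yes refl | _ rewrite Ax | inc-left {v = x} (x≢y ∘ ≡-sym) | dx = ≤-refl
      ... | no _ | yes refl rewrite Ay | inc-right {v = y} x≢y | dy = ≤-refl
      ... | no z≢x | no z≢y rewrite inc-≢ {v = z} (z≢x ∘ ≡-sym) (z≢y ∘ ≡-sym) = d z

    maximum-covers : ∀ {x y M} → x ≢ y → Adj (x , y) → A x ≡ true → A y ≡ true → Matching A M → size M ≡ ν →
                     deg x M ≡ 0 → deg y M ≢ 0
    maximum-covers {x} {y} {M} x≢y xy Ax Ay m s dx dy =
      <⇒≱ (subst (_< suc (size M)) s ≤-refl) (max _ (addEdge x≢y xy Ax Ay dx dy m))

    -- By counting, some x ≠ t is covered by M₁ and missed by C ++ N₁.  If xy ∈ M₁ and yz ∈ N₁, replacing yz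
    -- by xy in C ++ N₁ enlarges the common part C.
    exchange : ∀ k C M₁ N₁ {u v t} → u ≢ v → ¬ MissBoth u t → ¬ MissBoth t v → size M₁ ≤ k →
      Matching A (C ++ M₁) → size (C ++ M₁) ≡ ν → deg u (C ++ M₁) ≡ 0 → deg v (C ++ M₁) ≡ 0 →
      Matching A (C ++ N₁) → size (C ++ N₁) ≡ ν → deg t (C ++ N₁) ≡ 0 → ⊥
    exchange k C M₁ N₁ {u} {v} {t} u≢v ut tv M₁≤k mM sM Mu Mv mN sN Nt =
      let x , bad = Finₚ.¬∀⟶∃¬ N _ le? notAll in step k x bad M₁≤k
      where
      M = C ++ M₁
      Nₘ = C ++ N₁
      Nu : deg u Nₘ ≢ 0
      Nu h = ut (Nₘ , mN , sN , h , Nt)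
      Nv : deg v Nₘ ≢ 0
      Nv h = tv (Nₘ , mN , sN , Nt , h)
      -- Summed over all vertices the left side is 2ν + 2 and the right side 2ν + 1, so the
      -- inequality fails at some `x`. As the left side never exceeds 1, the right side is 0 there:
      -- `Nₘ` misses `x` and `x` is not `t`. Since `Nₘ` covers `u` and `v`, `x` is neither of them,
      -- so `M` covers it.
      Le : Fin N → Set
      Le z = deg z M + (δ u z + δ v z) ≤ deg z Nₘ + δ t z
      le? : ∀ z → Dec (Le z)
      le? z = _ ≤? _
      sumM : Σ-fin (λ z → deg z M + (δ u z + δ v z)) ≡ (ν + ν) + 2
      sumM = trans (Σ-+ (λ z → deg z M) (λ z → δ u z + δ v z))
        (cong₂ _+_ (trans (Σ-deg M) (cong₂ _+_ sM sM)) (trans (Σ-+ (δ u) (δ v)) (cong₂ _+_ (Σ-δ₁ u) (Σ-δ₁ v))))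
      sumN : Σ-fin (λ z → deg z Nₘ + δ t z) ≡ (ν + ν) + 1
      sumN = trans (Σ-+ (λ z → deg z Nₘ) (δ t)) (cong₂ _+_ (trans (Σ-deg Nₘ) (cong₂ _+_ sN sN)) (Σ-δ₁ t))
      notAll : ¬ (∀ z → Le z)
      notAll h = <⇒≱ (+-monoʳ-< (ν + ν) (s≤s (s≤s z≤n))) (subst₂ _≤_ sumM sumN (Σ-mono h))
      deg≤1 : ∀ {L} → Matching A L → ∀ z → deg z L ≤ 1
      deg≤1 m z = ≤-trans (proj₂ m z) (bit≤1 (A z))
      atMost1 : ∀ z → deg z M + (δ u z + δ v z) ≤ 1
      atMost1 z with u Fin.≟ z | v Fin.≟ z
      ... | yes refl | yes refl = contradiction refl u≢v
      ... | yes refl | no _  rewrite Mu = ≤-refl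
      ... | no _ | yes refl  rewrite Mv = ≤-refl
      ... | no _ | no _ rewrite +-identityʳ (deg z M) = deg≤1 mM z
      step : ∀ k x → ¬ Le x → size M₁ ≤ k → ⊥
      step k x bad M₁≤k = conclude k (pull-deg x M₁ M₁x) M₁≤k
        where
        Nx : deg x Nₘ ≡ 0
        Nx with deg x Nₘ ≟ 0
        ... | yes p = p
        ... | no p  = contradiction (≤-trans (atMost1 x) (≤-trans (n≢0⇒n>0 p) (m≤m+n _ _))) bad
        x≢t : x ≢ t
        x≢t refl = bad (≤-trans (atMost1 x) (≤-trans (≤-reflexive (≡-sym (δ-refl x))) (m≤n+m _ (deg x Nₘ))))
        u≢x : u ≢ x
        u≢x refl = Nu Nx
        v≢x : v ≢ x
        v≢x refl = Nv Nx
        Mx : deg x M ≢ 0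
        Mx h = bad (subst (_≤ deg x Nₘ + δ t x) (≡-sym (cong₂ _+_ h (cong₂ _+_ (δ-≢ u≢x) (δ-≢ v≢x)))) z≤n)
        Cx : deg x C ≡ 0
        Cx = m+n≡0⇒m≡0 (deg x C) (trans (≡-sym (W-++ (inc x) C N₁)) Nx)
        M₁x : 1 ≤ deg x M₁
        M₁x = n≢0⇒n>0 λ h → Mx (trans (W-++ (inc x) C M₁) (cong₂ _+_ Cx h))
        conclude : ∀ k → (∃ λ y → ∃ λ M₂ → M₁ ≈ (x , y) ∷ M₂) → size M₁ ≤ k → ⊥
        -- The recursion ends here: `M₁` contains an edge at `x`, so its size cannot be bounded by
        -- 0.
        conclude zero (y , M₂ , p) le with () ← subst (_≤ 0) (W-≈ {f = λ _ → 1} (λ _ _ → refl) p) le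
        conclude (suc k) (y , M₂ , p) le = final (pull-deg y N₁ N₁y)
          where
          M≈ : M ≈ (x , y) ∷ C ++ M₂
          M≈ = ≈-trans (≈-++ʳ C p) (≈-sym (≈-shift C))
          mM′ : Matching A ((x , y) ∷ C ++ M₂)
          mM′ = Matching-≈ M≈ mM
          y≢x : y ≢ x
          y≢x refl = <⇒≱ (s≤s (s≤s z≤n)) (≤-trans (m≤m+n 2 (deg x (C ++ M₂)))
                       (≤-trans (≤-reflexive (cong (_+ deg x (C ++ M₂)) (≡-sym (inc-loop x)))) (deg≤1 mM′ x)))
          Ax : A x ≡ true
          Ax = bit-true (≤-trans (n≢0⇒n>0 Mx) (proj₂ mM x))
          Ay : A y ≡ true
          Ay = bit-true (≤-trans (deg-∷-head₂ x y (C ++ M₂)) (proj₂ mM′ y))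
          -- Otherwise `xy` could be added to `Nₘ`, which is maximum.
          Ny : deg y Nₘ ≢ 0
          Ny = maximum-covers (y≢x ∘ ≡-sym) (All.head (proj₁ mM′)) Ax Ay mN sN Nx
          Cy : deg y C ≡ 0
          Cy = m+n≡0⇒m≡0 (deg y C) (n≤0⇒n≡0 (s≤s⁻¹ (subst (_≤ 1)
                 (trans (cong (_+ deg y (C ++ M₂)) (inc-right {v = y} (y≢x ∘ ≡-sym))) (cong suc (W-++ (inc y) C M₂))) (deg≤1 mM′ y))))
          N₁y : 1 ≤ deg y N₁
          N₁y = n≢0⇒n>0 λ h → Ny (trans (W-++ (inc y) C N₁) (cong₂ _+_ Cy h))
          final : (∃ λ z → ∃ λ N₂ → N₁ ≈ (y , z) ∷ N₂) → ⊥
          final (z , N₂ , q) = exchange k ((x , y) ∷ C) M₂ N₂ u≢v ut tv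
              (s≤s⁻¹ (subst (_≤ suc k) (W-≈ {f = λ _ → 1} (λ _ _ → refl) p) le))
              mM′ (trans (≡-sym (W-≈ {f = λ _ → 1} (λ _ _ → refl) M≈)) sM)
              (trans (≡-sym (deg-≈ u M≈)) Mu) (trans (≡-sym (deg-≈ v M≈)) Mv)
              (addEdge (y≢x ∘ ≡-sym) (All.head (proj₁ mM′)) Ax Ay (below x Nx) Cy₂ mN₂)
              (trans (≡-sym (W-≈ {f = λ _ → 1} (λ _ _ → refl) N≈)) sN)
              (cong₂ _+_ (inc-≢ x≢t y≢t) (below t Nt))
            where
            N≈ : Nₘ ≈ (y , z) ∷ C ++ N₂
            N≈ = ≈-trans (≈-++ʳ C q) (≈-sym (≈-shift C))
            mN′ : Matching A ((y , z) ∷ C ++ N₂)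
            mN′ = Matching-≈ N≈ mN
            mN₂ : Matching A (C ++ N₂)
            mN₂ = All.tail (proj₁ mN′) , λ w → ≤-trans (m≤n+m _ (inc w (y , z))) (proj₂ mN′ w)
            below : ∀ w → deg w Nₘ ≡ 0 → deg w (C ++ N₂) ≡ 0
            below w h = m+n≡0⇒n≡0 (inc w (y , z)) (trans (≡-sym (deg-≈ w N≈)) h)
            y≢t : y ≢ t
            y≢t refl = Ny Nt
            Cy₂ : deg y (C ++ N₂) ≡ 0
            Cy₂ = n≤0⇒n≡0 (s≤s⁻¹ (≤-trans (+-monoˡ-≤ (deg y (C ++ N₂))
                    (subst (λ d → 1 ≤ d + δ z y) (≡-sym (δ-refl y)) (s≤s z≤n))) (deg≤1 mN′ y)))

    -- Equality has to be added by hand, because a vertex missed by a maximum matching satisfies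
    -- `MissBoth u u`.
    Related : Fin N → Fin N → Set
    Related u v = u ≡ v ⊎ ¬ MissBoth u v

    related-sym : ∀ {u v} → Related u v → Related v u
    related-sym (inj₁ p) = inj₁ (≡-sym p)
    related-sym (inj₂ h) = inj₂ λ (M , m , s , p , q) → h (M , m , s , q , p)

    related-trans : ∀ {u t v} → MissBoth t t → Related u t → Related t v → Related u v
    related-trans missed (inj₁ refl) r = r
    related-trans missed r (inj₁ refl) = r
    related-trans {u} {t} {v} (L , mL , sL , Lt , _) (inj₂ ut) (inj₂ tv) with u Fin.≟ v
    ... | yes u≡v = inj₁ u≡v
    ... | no u≢v  = inj₂ λ (M , m , s , p , q) → exchange (size M) [] M L u≢v ut tv ≤-refl m s p q mL sL Lt

    related-adj : ∀ {a b} → Adj (a , b) → A a ≡ true → A b ≡ true → Related a b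
    related-adj {a} {b} ab Aa Ab with a Fin.≟ b
    ... | yes a≡b = inj₁ a≡b
    ... | no a≢b  = inj₂ λ (M , m , s , p , q) → maximum-covers a≢b ab Aa Ab m s p q

    -- The Tutte set is empty, and each vertex missed by `M` represents its class. Adjacent vertices
    -- are related, so classes are closed and edges of `M` stay inside them. Two vertices missed by
    -- `M` are unrelated, so `M` misses only the representative of such a class and pairs off the
    -- rest: the class is odd. The number of representatives is at least |A| - 2ν.
    factorCritical : ∀ M → Matching A M → size M ≡ ν → (∀ v → A v ≡ true → MissBoth v v) →
                     (∀ u v → Dec (MissBoth u v)) →
                     Σ (Barrier A) λ B → count (Barrier.S B) + count A ≤ count (Barrier.R B) + (ν + ν)
    factorCritical M m s missed missBoth? = record
      { S = λ _ → false ; R = R ; C = C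
      ; C⊆A = λ {r} {v} _ c → proj₁ (does⇒ (C? r v) c)
      ; C∩S = λ _ _ → refl
      ; C-disjoint = disjoint
      ; C-closed = λ {r} {a} {b} _ c ab Ab _ → closed {r} c ab Ab
      ; C-odd = λ {r} Rr → W (λ (a , b) → bit (C r a)) M , odd r Rr
      } , enough
      where
      R? : ∀ r → Dec (A r ≡ true × deg r M ≡ 0)
      R? r = (A r Boolₚ.≟ true) ×-dec (deg r M ≟ 0)
      R : Fin N → Bool
      R r = does (R? r)
      C? : ∀ r v → Dec (A v ≡ true × Related r v)
      C? r v = (A v Boolₚ.≟ true) ×-dec ((r Fin.≟ v) ⊎-dec ¬? (missBoth? r v))
      C : Fin N → Fin N → Bool
      C r v = does (C? r v)
      disjoint : ∀ {r r′ v} → R r ≡ true → R r′ ≡ true → C r v ≡ true → C r′ v ≡ true → r ≡ r′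
      disjoint {r} {r′} {v} Rr Rr′ c c′ with does⇒ (R? r) Rr | does⇒ (R? r′) Rr′ | does⇒ (C? r v) c | does⇒ (C? r′ v) c′
      ... | Ar , dr | Ar′ , dr′ | Av , rv | _ , r′v with related-trans (missed v Av) rv (related-sym r′v)
      ...   | inj₁ p = p
      ...   | inj₂ h = contradiction (M , m , s , dr , dr′) h
      closed : ∀ {r a b} → C r a ≡ true → Adj (a , b) → A b ≡ true → C r b ≡ true
      closed {r} {a} {b} c ab Ab with does⇒ (C? r a) c
      ... | Aa , ra = dec-true (C? r b) (Ab , related-trans (missed a Aa) ra (related-adj ab Aa Ab))
      sameClass : ∀ r L → All Adj L → (∀ v → deg v L ≤ bit (A v)) → All (λ (a , b) → bit (C r b) ≡ bit (C r a)) L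
      sameClass r [] [] _ = []
      sameClass r ((a , b) ∷ L) (ab ∷ adj) d = same ∷ sameClass r L adj (λ v → ≤-trans (m≤n+m _ (inc v (a , b))) (d v))
        where
        Aa = bit-true (≤-trans (deg-∷-head a b L) (d a))
        Ab = bit-true (≤-trans (deg-∷-head₂ a b L) (d b))
        same : bit (C r b) ≡ bit (C r a)
        same with C r a in ca | C r b in cb
        ... | true  | true  = refl
        ... | false | false = refl
        ... | true  | false = ⊥-elim (false≢true (trans (≡-sym cb) (closed {r} ca ab Ab)))
        ... | false | true  = ⊥-elim (false≢true (trans (≡-sym ca) (closed {r} cb (Adj-flip a b ab) Aa)))
      odd : ∀ r → R r ≡ true → count (C r) ≡ suc (W (λ (a , b) → bit (C r a)) M + W (λ (a , b) → bit (C r a)) M)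
      odd r Rr = begin
        count (C r)                                             ≡⟨ Σ-cong split ⟩
        Σ-fin (λ v → δ r v + bit (C r v) * deg v M)             ≡⟨ Σ-+ (δ r) (λ v → bit (C r v) * deg v M) ⟩
        Σ-fin (δ r) + Σ-fin (λ v → bit (C r v) * deg v M)       ≡⟨ cong₂ _+_ (Σ-δ₁ r) (handshake (bit ∘ C r) M) ⟩
        suc (W (λ (a , b) → bit (C r a) + bit (C r b)) M)
          ≡⟨ cong suc (W-congᴬ (All.map (λ {e} p → cong (bit (C r (proj₁ e)) +_) p) (sameClass r M (proj₁ m) (proj₂ m)))) ⟩
        suc (W (λ (a , b) → bit (C r a) + bit (C r a)) M)       ≡⟨ cong suc (W-+ (λ (a , b) → bit (C r a)) _ M) ⟩
        suc (W (λ (a , b) → bit (C r a)) M + W (λ (a , b) → bit (C r a)) M) ∎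
        where
        open ≡-Reasoning
        Ar = proj₁ (does⇒ (R? r) Rr)
        dr = proj₂ (does⇒ (R? r) Rr)
        split : ∀ v → bit (C r v) ≡ δ r v + bit (C r v) * deg v M
        split v with C r v in c
        ... | false = ≡-sym (cong (_+ 0) (δ-≢ {a = r} {v} λ { refl → false≢true (trans (≡-sym c) (dec-true (C? r r) (Ar , inj₁ refl))) }))
        ... | true  = ≡-sym (trans (cong (δ r v +_) (+-identityʳ (deg v M))) (onClass (r Fin.≟ v)))
          where
          onClass : Dec (r ≡ v) → δ r v + deg v M ≡ 1
          onClass (yes refl) = cong₂ _+_ (δ-refl r) dr
          onClass (no r≢v) with proj₂ (does⇒ (C? r v) c)
          ... | inj₁ p = contradiction p r≢v
          ... | inj₂ h = cong₂ _+_ (δ-≢ r≢v)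
                (≤1∧≢0⇒≡1 (≤-trans (proj₂ m v) (bit≤1 (A v))) λ dv → h (M , m , s , dr , dv))
      enough : count {N} (λ _ → false) + count A ≤ count R + (ν + ν)
      enough = begin
        count {N} (λ _ → false) + count A        ≡⟨ cong (_+ count A) (Σ-0 N) ⟩
        count A                              ≤⟨ Σ-mono cover ⟩
        Σ-fin (λ v → bit (R v) + deg v M)    ≡⟨ Σ-+ (bit ∘ R) (λ v → deg v M) ⟩
        count R + Σ-fin (λ v → deg v M)      ≡⟨ cong (count R +_) (trans (Σ-deg M) (cong₂ _+_ s s)) ⟩
        count R + (ν + ν) ∎
        where
        open ≤-Reasoning
        cover : ∀ v → bit (A v) ≤ bit (R v) + deg v M
        cover v = [ (λ d → ≤-trans (inR d) (m≤m+n _ _)) , (λ d → ≤-trans (bit≤1 (A v)) (≤-trans (n≢0⇒n>0 d) (m≤n+m _ _))) ]′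
                    (toSum (deg v M ≟ 0))
          where
          inR : deg v M ≡ 0 → bit (A v) ≤ bit (R v)
          inR d = [ (λ Av → ≤-trans (bit≤1 (A v)) (≤-reflexive (cong bit (≡-sym (dec-true (R? v) (Av , d))))))
                  , (λ ¬Av → subst (λ a → bit a ≤ bit (R v)) (≡-sym (Boolₚ.¬-not ¬Av)) z≤n) ]′ (toSum (A v Boolₚ.≟ true))

  -- The Tutte-Berge formula

  Tight : (Fin N → Bool) → Set
  Tight A = ∃ λ M → Matching A M × Σ (Barrier A) λ B →
            count (Barrier.S B) + count A ≤ count (Barrier.R B) + (size M + size M)

  Maximum : (Fin N → Bool) → List (Edge N) → Set
  Maximum A M = Matching A M × (∀ M′ → Matching A M′ → size M′ ≤ size M)

  matching-size : ∀ {A M} → Matching A M → size M + size M ≤ count A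
  matching-size {A} {M} m = subst (_≤ count A) (Σ-deg M) (Σ-mono (proj₂ m))

  -- If no maximum existed, every matching could be enlarged. `k` bounds the number of enlargements,
  -- since the size never exceeds `count A`.
  maximum-exists : ∀ {A} k M → Matching A M → count A ≤ size M + k → ¬ ¬ ∃ (Maximum A)
  maximum-exists zero M m h none = none (M , m , λ M′ m′ →
    ≤-trans (m≤m+n _ _) (≤-trans (matching-size m′) (≤-trans h (≤-reflexive (+-identityʳ (size M))))))
  maximum-exists (suc k) M m h none = none (M , m , largest)
    where
    largest : ∀ M′ → Matching _ M′ → size M′ ≤ size M
    largest M′ m′ with size M′ ≤? size M
    ... | yes p = p
    ... | no p  = ⊥-elim (maximum-exists k M′ m′
            (≤-trans h (≤-trans (≤-reflexive (+-suc (size M) k)) (+-monoˡ-≤ k (≰⇒> p)))) none)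

  -- The pieces already avoid `v`, and they stay closed in `A` because `v` joins the Tutte set. The
  -- size is only bounded, since `S` may have contained `v` before.
  addToBarrier : ∀ {A v} → A v ≡ true → (B : Barrier (without A v)) →
                 Σ (Barrier A) λ B′ → count (Barrier.S B′) ≤ suc (count (Barrier.S B)) × count (Barrier.R B′) ≡ count (Barrier.R B)
  addToBarrier {A} {v} Av B = record
    { S = S′ ; R = R ; C = C
    ; C⊆A = λ Rr c → proj₁ (without-⊆ A v (C⊆A Rr c))
    ; C∩S = λ Rr c → trans (S′-≢ (proj₂ (without-⊆ A v (C⊆A Rr c)))) (C∩S Rr c)
    ; C-disjoint = C-disjoint
    ; C-closed = λ Rr c ab Ab Sb → C-closed Rr c ab (trans (without-≢ A (v≢ Sb)) Ab) (trans (≡-sym (S′-≢ (v≢ Sb))) Sb)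
    ; C-odd = C-odd
    } , fewer , refl
    where
    open Barrier B
    S′ : Fin N → Bool
    S′ z = S z ∨ does (v Fin.≟ z)
    S′-≢ : ∀ {z} → v ≢ z → S′ z ≡ S z
    S′-≢ {z} v≢z rewrite dec-false (v Fin.≟ z) v≢z = Boolₚ.∨-identityʳ (S z)
    v≢ : ∀ {z} → S′ z ≡ false → v ≢ z
    v≢ h refl rewrite dec-true (v Fin.≟ v) refl | Boolₚ.∨-zeroʳ (S v) with () ← h
    fewer : count S′ ≤ suc (count S)
    fewer = begin
      count S′                         ≤⟨ Σ-mono le ⟩
      Σ-fin (λ z → δ v z + bit (S z))  ≡⟨ Σ-+ (δ v) (bit ∘ S) ⟩
      Σ-fin (δ v) + count S            ≡⟨ cong (_+ count S) (Σ-δ₁ v) ⟩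
      suc (count S) ∎
      where
      open ≤-Reasoning
      le : ∀ z → bit (S′ z) ≤ δ v z + bit (S z)
      le z with does (v Fin.≟ z)
      ... | true  = ≤-trans (bit≤1 _) (s≤s z≤n)
      ... | false rewrite Boolₚ.∨-identityʳ (S z) = ≤-refl

  -- Induction on |A|. If every vertex of `A` is missed by some maximum matching, Gallai's lemma
  -- provides the barrier. Otherwise some `v` is covered by all of them. Deleting `v` lowers the
  -- matching number; putting `v` back into the Tutte set adds at most two to |S| + |A|, and the
  -- larger matching pays at least two for it.
  tutteBerge : ∀ k A → count A ≡ k → ¬ ¬ Tight A
  tutteBerge k A cA none = maximum-exists (count A) [] ([] , λ _ → z≤n) ≤-refl λ (M , m , max) → withMaximum k cA M m max
    where
    withMaximum : ∀ k → count A ≡ k → ∀ M → Matching A M → (∀ M′ → Matching A M′ → size M′ ≤ size M) → ⊥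
    withMaximum k cA M m max =
      ¬¬-∀Fin (λ u → ¬¬-∀Fin (λ v → ¬¬-excluded-middle)) λ missBoth? →
        [ (λ all → none (M , m , factorCritical M m refl (missed all) missBoth?)) , (λ ¬all →
          let v , bad = Finₚ.¬∀⟶∃¬ N _ (ok? missBoth?) ¬all in essential k cA v (isAlive bad) (bad ∘ inj₂)) ]′
          (toSum (Finₚ.all? (ok? missBoth?)))
      where
      open Gallai A (size M) max
      Ok : Fin N → Set
      Ok v = A v ≡ false ⊎ MissBoth v v
      ok? : (∀ u v → Dec (MissBoth u v)) → ∀ v → Dec (Ok v)
      ok? missBoth? v = (A v Boolₚ.≟ false) ⊎-dec missBoth? v v
      missed : (∀ v → Ok v) → ∀ v → A v ≡ true → MissBoth v v
      missed all v Av = [ (λ p → ⊥-elim (false≢true (trans (≡-sym p) Av))) , id ]′ (all v)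
      isAlive : ∀ {v} → ¬ Ok v → A v ≡ true
      isAlive bad = Boolₚ.¬-not (bad ∘ inj₁)
      essential : ∀ k → count A ≡ k → ∀ v → A v ≡ true → ¬ MissBoth v v → ⊥
      essential zero cA v Av covered with () ← trans (≡-sym cA) (count-without A v Av)
      essential (suc k) cA v Av covered =
        tutteBerge k (without A v) (suc-injective (trans (≡-sym (count-without A v Av)) cA)) λ (M′ , m′ , B , le) →
          let B′ , S≤ , R≡ = addToBarrier Av B
              mA = proj₁ m′ , λ z → ≤-trans (proj₂ m′ z) (bit-mono z)
              dv : deg v M′ ≡ 0
              dv = n≤0⇒n≡0 (subst (λ b → deg v M′ ≤ bit b) (without-≡ A v) (proj₂ m′ v))
              lt : size M′ < size M
              lt = ≤∧≢⇒< (max M′ mA) λ s → covered (M′ , mA , s , dv , dv)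
          in none (M , m , B′ , bound S≤ R≡ lt le)
        where
        bit-mono : ∀ z → bit (without A v z) ≤ bit (A z)
        bit-mono z with A z
        ... | true  = bit≤1 _
        ... | false = z≤n
        bound : ∀ {s s′ r r′ m′} → s′ ≤ suc s → r′ ≡ r → m′ < size M → s + count (without A v) ≤ r + (m′ + m′) →
                s′ + count A ≤ r′ + (size M + size M)
        bound {s} {s′} {r} {r′} {m′} s′≤ refl lt le = begin
          s′ + count A                             ≡⟨ cong (s′ +_) (count-without A v Av) ⟩
          s′ + suc (count (without A v))           ≤⟨ +-monoˡ-≤ _ s′≤ ⟩
          suc s + suc (count (without A v))        ≡⟨ cong suc (+-suc s _) ⟩
          2 + (s + count (without A v))            ≤⟨ +-monoʳ-≤ 2 le ⟩
          2 + (r + (m′ + m′))                      ≡⟨ solve 2 (λ r m → con 2 :+ (r :+ (m :+ m)) := r :+ ((con 1 :+ m) :+ (con 1 :+ m))) refl r m′ ⟩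
          r + (suc m′ + suc m′)                    ≤⟨ +-monoʳ-≤ r (+-mono-≤ lt lt) ⟩
          r + (size M + size M) ∎
          where open ≤-Reasoning

Σ-tight : ∀ {n} {f g : Fin n → ℕ} → (∀ i → f i ≤ g i) → Σ-fin f ≡ Σ-fin g → ∀ i → f i ≡ g i
Σ-tight {f = f} {g} le eq i with f i ≟ g i
... | yes p = p
... | no p  = ⊥-elim (1+n≰n (subst₂ _≤_ (trans (Σ-+ (δ i) f) (cong₂ _+_ (Σ-δ₁ i) eq)) refl (Σ-mono le′)))
  where
  le′ : ∀ j → δ i j + f j ≤ g j
  le′ j with i Fin.≟ j
  ... | yes refl = ≤∧≢⇒< (le i) p
  ... | no _     = le j

Σ-positive : ∀ {n} (f : Fin n → ℕ) → Σ-fin f ≢ 0 → ∃ λ x → f x ≢ 0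
Σ-positive {n} f h = Finₚ.¬∀⟶∃¬ n _ (λ x → f x ≟ 0) λ all → h (trans (Σ-cong all) (Σ-0 n))

Σ-unique : ∀ {n} (f : Fin n → ℕ) → Σ-fin f ≡ 1 → ∃ λ x → f x ≡ 1 × (∀ v → v ≢ x → f v ≡ 0)
Σ-unique f h with Σ-positive f (λ p → 0≢1+n (trans (≡-sym p) h))
... | x , fx = x , ≤1∧≢0⇒≡1 (subst (f x ≤_) h (term≤Σ f x)) fx , others
  where
  others : ∀ v → v ≢ x → f v ≡ 0
  others v v≢x with f v ≟ 0
  ... | yes p = p
  ... | no fv = ⊥-elim (1+n≰n (subst₂ _≤_ (trans (Σ-+ (δ v) (δ x)) (cong₂ _+_ (Σ-δ₁ v) (Σ-δ₁ x))) h (Σ-mono le)))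
    where
    le : ∀ z → δ v z + δ x z ≤ f z
    le z with v Fin.≟ z | x Fin.≟ z
    ... | yes refl | yes refl = contradiction refl v≢x
    ... | yes refl | no _     = n≢0⇒n>0 fv
    ... | no _     | yes refl = n≢0⇒n>0 fx
    ... | no _     | no _     = z≤n

double≢odd : ∀ m n → m + m ≢ suc (n + n)
double≢odd m n h = even≢odd m n (trans (cong (m +_) (+-identityʳ m))
  (trans h (cong (λ k → suc (n + k)) (≡-sym (+-identityʳ n)))))

evenOrOdd : ∀ n → (∃ λ h → n ≡ h + h) ⊎ (∃ λ h → n ≡ suc (h + h))
evenOrOdd zero = inj₁ (0 , refl)
evenOrOdd (suc n) with evenOrOdd n
... | inj₁ (h , refl) = inj₂ (h , refl)
... | inj₂ (h , refl) = inj₁ (suc h , cong suc (≡-sym (+-suc h h)))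

monochromatic : ∀ {n} (c : Bool) (E : List (Edge n)) → Colouring E
monochromatic c = All.universal (λ _ → c)

red-all : ∀ {n} (E : List (Edge n)) → red (monochromatic true E) ≡ E
red-all []      = refl
red-all (e ∷ E) = cong (e ∷_) (red-all E)

red-none : ∀ {n} (E : List (Edge n)) → red (monochromatic false E) ≡ []
red-none []      = refl
red-none (e ∷ E) = red-none E

selfAdj : ∀ {n} (I : List (Edge n)) → All (Adj I) I
selfAdj []            = []
selfAdj ((a , b) ∷ I) = ≤-trans (≤-reflexive (≡-sym (mul-refl a b))) (m≤m+n _ _) ∷
  All.map (λ {e} h → ≤-trans h (m≤n+m _ (mul (proj₁ e) (proj₂ e) (a , b)))) (selfAdj I)

Perfect : ∀ {n} → List (Edge n) → (Fin n → Bool) → Set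
Perfect I A = ∃ λ M → All (Adj I) M × (∀ v → deg v M ≡ bit (A v))

-- A matching is only known to consist of adjacent pairs. Its degrees are at most 1, so no pair
-- repeats and it really is a part of the edge list, which can be coloured red.
perfectColouring : ∀ {n} {I : List (Edge n)} {A} → Perfect I A → Σ (Colouring I) λ cs → ∀ v → deg v (red cs) ≡ bit (A v)
perfectColouring {I = I} {A} (M , adj , d) with pull-all M I (All.map (λ {e} → single e) adj)
  where
  single : ∀ e → Adj I e → W (mul (proj₁ e) (proj₂ e)) M ≤ W (mul (proj₁ e) (proj₂ e)) I
  single (a , b) h = ≤-trans (W-mono M (λ e → ≤-trans (term≤Σ (λ b → mul a b e) b)
    (≤-trans (m≤m+n _ (mul a a e)) (≤-reflexive (Σ-mul a e))))) (≤-trans (≤-reflexive (d a)) (≤-trans (bit≤1 (A a)) h))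
... | E′ , p with recolour (≈-sym p) (monochromatic true M ++ᶜ monochromatic false E′)
...   | cs , q = cs , λ v → trans (≡-sym (deg-≈ v q)) (trans (W-red-++ (inc v) (monochromatic true M) (monochromatic false E′))
          (trans (cong₂ _+_ (cong (deg v) (red-all M)) (cong (deg v) (red-none E′))) (trans (+-identityʳ _) (d v))))

-- Since |A| = 2h is even, a matching that is not perfect falls short by at least two vertices. This
-- is the surplus of two pieces over the Tutte set.
tutte : ∀ {n} (I : List (Edge n)) A h → count A ≡ h + h → ¬ Perfect I A →
        ¬ ¬ Σ (Barrier I A) λ B → 2 + count (Barrier.S B) ≤ count (Barrier.R B)
tutte I A h cA none k = tutteBerge I (count A) A refl λ (M , m , B , le) → deficient M m B le
  where
  deficient : ∀ M → Matching I A M → (B : Barrier I A) →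
              count (Barrier.S B) + count A ≤ count (Barrier.R B) + (size M + size M) → ⊥
  deficient M m B le with size M ≟ h
  -- With `h` edges the degrees sum to |A|, so every bound `deg v M ≤ bit (A v)` is attained and the
  -- matching is perfect.
  ... | yes refl = none (M , proj₁ m , Σ-tight (proj₂ m) (trans (Σ-deg M) (≡-sym cA)))
  ... | no p = k (B , +-cancelʳ-≤ (size M + size M) _ _ (begin
      2 + count S + (size M + size M)
        ≡⟨ solve 2 (λ s m → con 2 :+ s :+ (m :+ m) := s :+ ((con 1 :+ m) :+ (con 1 :+ m))) refl (count S) (size M) ⟩
      count S + (suc (size M) + suc (size M))   ≤⟨ +-monoʳ-≤ (count S) (+-mono-≤ small small) ⟩
      count S + (h + h)                         ≡⟨ cong (count S +_) (≡-sym cA) ⟩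
      count S + count A                         ≤⟨ le ⟩
      count R + (size M + size M) ∎))
    where
    open ≤-Reasoning
    open Barrier B
    small : size M < h
    small = ≰⇒> λ h≤ → p (≤-antisym (half (subst (size M + size M ≤_) cA (matching-size I m))) h≤)
      where
      half : ∀ {a b} → a + a ≤ b + b → a ≤ b
      half {a} {b} q = ≮⇒≥ λ b<a → <⇒≱ (+-mono-< b<a b<a) q

-- Counting the edges that leave the pieces of a barrier

cross : ∀ {n} → (Fin n → Bool) → Edge n → ℕ
cross P (a , b) = bit (P a xor P b)

within : ∀ {n} → (Fin n → Bool) → Edge n → ℕ
within P (a , b) = bit (P a ∧ P b)

loopIn : ∀ {n} → (Fin n → Bool) → Edge n → ℕ
loopIn P (a , b) = bit (P a) * δ a b

cross-flip : ∀ {n} (P : Fin n → Bool) → Symm (cross P)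
cross-flip P a b = cong bit (Boolₚ.xor-comm (P a) (P b))

cross-within : ∀ {n} (P : Fin n → Bool) e → bit (P (proj₁ e)) + bit (P (proj₂ e)) ≡ cross P e + (within P e + within P e)
cross-within P (a , b) with P a | P b
... | true  | true  = refl
... | true  | false = refl
... | false | true  = refl
... | false | false = refl

module BarrierCount {n : ℕ} {I : List (Edge n)} {A : Fin n → Bool} (B : Barrier I A) where
  open Barrier B

  classes : Fin n → ℕ
  classes a = Σ-fin (λ r → bit (R r) * bit (C r a))

  crossings : Edge n → ℕ
  crossings e = Σ-fin (λ r → bit (R r) * cross (C r) e)

  crossings-flip : Symm crossings
  crossings-flip a b = Σ-cong λ r → cong (bit (R r) *_) (cross-flip (C r) a b)

  classes-none : ∀ {a} → (∀ r → R r ≡ true → C r a ≡ false) → classes a ≡ 0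
  classes-none {a} h = trans (Σ-cong zeros) (Σ-0 n)
    where
    zeros : ∀ r → bit (R r) * bit (C r a) ≡ 0
    zeros r with R r in Rr
    ... | false = refl
    ... | true rewrite h r Rr = refl

  outside : ∀ {a} → A a ≡ false ⊎ S a ≡ true → classes a ≡ 0
  outside {a} h = classes-none λ r Rr → Boolₚ.¬-not λ c →
    [ (λ p → false≢true (trans (≡-sym p) (C⊆A Rr c))) , (λ p → false≢true (trans (≡-sym (C∩S Rr c)) p)) ]′ h

  classes≤1 : ∀ a → classes a ≤ 1
  classes≤1 a with classes a ≟ 0
  ... | yes p = subst (_≤ 1) (≡-sym p) z≤n
  ... | no p with Σ-positive (λ r → bit (R r) * bit (C r a)) p
  ...   | r₀ , h = subst (classes a ≤_) (Σ-δ₁ r₀) (Σ-mono le)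
    where
    in₀ : R r₀ ≡ true × C r₀ a ≡ true
    in₀ with R r₀ | C r₀ a
    ... | true  | true  = refl , refl
    ... | true  | false = contradiction refl h
    ... | false | _     = contradiction refl h
    le : ∀ r → bit (R r) * bit (C r a) ≤ δ r₀ r
    le r with R r in Rr | C r a in Cra
    ... | false | _     = z≤n
    ... | true  | false = z≤n
    ... | true  | true rewrite C-disjoint (proj₁ in₀) Rr (proj₂ in₀) Cra = ≤-reflexive (≡-sym (δ-refl r))

  classes≤ : ∀ a → classes a ≤ bit (A a)
  classes≤ a with A a in Aa
  ... | true  = classes≤1 a
  ... | false = ≤-reflexive (outside (inj₁ Aa))

  crossings≤classes : ∀ a b → crossings (a , b) ≤ classes a + classes b
  crossings≤classes a b = subst (crossings (a , b) ≤_)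
    (Σ-+ (λ r → bit (R r) * bit (C r a)) (λ r → bit (R r) * bit (C r b))) (Σ-mono le)
    where
    le : ∀ r → bit (R r) * bit (C r a xor C r b) ≤ bit (R r) * bit (C r a) + bit (R r) * bit (C r b)
    le r with R r | C r a | C r b
    ... | false | _     | _     = z≤n
    ... | true  | true  | true  = z≤n
    ... | true  | true  | false = ≤-refl
    ... | true  | false | true  = ≤-refl
    ... | true  | false | false = z≤n

  blocked : Fin n → Bool
  blocked v = S v ∨ not (A v)

  classes-blocked : ∀ {v} → blocked v ≡ true → classes v ≡ 0
  classes-blocked {v} h with S v in Sv | A v in Av
  ... | true  | _     = outside (inj₂ Sv)
  ... | false | false = outside (inj₁ Av)

  -- Pieces are closed, so an edge between two unblocked vertices leaves none of them. A blocked end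
  -- lies in no piece and the other end in at most one, so any other edge is counted at most once.
  crossings≤blocked : ∀ a b → Adj I (a , b) → crossings (a , b) ≤ bit (blocked a) + bit (blocked b)
  crossings≤blocked a b ab with blocked a in ba | blocked b in bb
  ... | true  | _    = ≤-trans (crossings≤classes a b) (≤-trans (+-monoˡ-≤ _ (≤-reflexive (classes-blocked ba))) (≤-trans (classes≤1 b) (m≤m+n 1 _)))
  ... | false | true = ≤-trans (crossings≤classes a b) (≤-trans (+-mono-≤ (classes≤1 a) (≤-reflexive (classes-blocked bb))) ≤-refl)
  ... | false | false = ≤-reflexive (trans (Σ-cong zeros) (Σ-0 n))
    where
    free : ∀ {v} → blocked v ≡ false → A v ≡ true × S v ≡ false
    free {v} h with S v | A v
    ... | false | true = refl , refl
    zeros : ∀ r → bit (R r) * bit (C r a xor C r b) ≡ 0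
    zeros r with R r in Rr | C r a in ca | C r b in cb
    ... | false | _     | _     = refl
    ... | true  | true  | true  = refl
    ... | true  | false | false = refl
    ... | true  | true  | false = ⊥-elim (false≢true (trans (≡-sym cb) (C-closed Rr ca ab (proj₁ (free bb)) (proj₂ (free bb)))))
    ... | true  | false | true  = ⊥-elim (false≢true (trans (≡-sym ca)
            (C-closed Rr cb (Adj-flip I a b ab) (proj₁ (free ba)) (proj₂ (free ba)))))

  loops≤ : ∀ E → Σ-fin (λ r → bit (R r) * W (loopIn (C r)) E) ≤ W (loopIn A) E
  loops≤ E = subst (_≤ W (loopIn A) E) (≡-sym (Σ-W (bit ∘ R) (λ r → loopIn (C r)) E)) (W-mono E le)
    where
    le : ∀ e → Σ-fin (λ r → bit (R r) * loopIn (C r) e) ≤ loopIn A e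
    le (a , b) = begin
      Σ-fin (λ r → bit (R r) * (bit (C r a) * δ a b))
        ≡⟨ Σ-cong (λ r → solve 3 (λ x y z → x :* (y :* z) := z :* (x :* y)) refl (bit (R r)) (bit (C r a)) (δ a b)) ⟩
      Σ-fin (λ r → δ a b * (bit (R r) * bit (C r a)))  ≡⟨ Σ-*ˡ (δ a b) (λ r → bit (R r) * bit (C r a)) ⟩
      δ a b * classes a                                ≡⟨ *-comm (δ a b) _ ⟩
      classes a * δ a b                                ≤⟨ *-monoˡ-≤ (δ a b) (classes≤ a) ⟩
      bit (A a) * δ a b ∎
      where open ≤-Reasoning

  -- The cut bound summed over all pieces. Their disjointness keeps the loops that they use within
  -- those of `A`.
  charge : ∀ E → (∀ {r} → R r ≡ true → 5 ≤ W (cross (C r)) E + (W (loopIn (C r)) E + W (loopIn (C r)) E)) →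
           5 * count R ≤ W crossings E + (W (loopIn A) E + W (loopIn A) E)
  charge E heavy = begin
    5 * count R
      ≡⟨ ≡-sym (Σ-*ˡ 5 (bit ∘ R)) ⟩
    Σ-fin (λ r → 5 * bit (R r))
      ≤⟨ Σ-mono le ⟩
    Σ-fin (λ r → x r + (y r + y r))
      ≡⟨ trans (Σ-+ x (λ r → y r + y r)) (cong (Σ-fin x +_) (Σ-+ y y)) ⟩
    Σ-fin x + (Σ-fin y + Σ-fin y)
      ≤⟨ +-mono-≤ (≤-reflexive (Σ-W (bit ∘ R) (λ r → cross (C r)) E)) (+-mono-≤ (loops≤ E) (loops≤ E)) ⟩
    W crossings E + (W (loopIn A) E + W (loopIn A) E) ∎
    where
    open ≤-Reasoning
    x y : Fin n → ℕ
    x r = bit (R r) * W (cross (C r)) E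
    y r = bit (R r) * W (loopIn (C r)) E
    le : ∀ r → 5 * bit (R r) ≤ x r + (y r + y r)
    le r with R r in Rr
    ... | false = z≤n
    ... | true rewrite +-identityʳ (W (cross (C r)) E) | +-identityʳ (W (loopIn (C r)) E) = heavy Rr

-- Odd cuts

Partition : ∀ {n} → (Fin n → Bool) → List (Edge n) → Set
Partition D E = ∃ λ I → ∃ λ X → E ≈ I ++ X ×
  All (λ (a , b) → D a ≡ true × D b ≡ true) I × All (λ (a , b) → D a ∧ D b ≡ false) X

partition : ∀ {n} (D : Fin n → Bool) (E : List (Edge n)) → Partition D E
partition D [] = [] , [] , ≈-refl , [] , []
partition D ((a , b) ∷ E) with partition D E | D a in Da | D b in Db
... | I , X , p , is , xs | true  | true  = (a , b) ∷ I , X , ≈-prep _ p , (Da , Db) ∷ is , xs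
... | I , X , p , is , xs | true  | false = I , (a , b) ∷ X , ≈-trans (≈-prep _ p) (≈-shift I) , is ,
        trans (cong₂ _∧_ Da Db) refl ∷ xs
... | I , X , p , is , xs | false | _ = I , (a , b) ∷ X , ≈-trans (≈-prep _ p) (≈-shift I) , is ,
        cong (_∧ D b) Da ∷ xs

red-loops : ∀ {n} (w : Fin n) k (cs : Colouring (replicate k (w , w))) →
            (∃ λ j → deg w (red cs) ≡ j + j) × (∀ v → v ≢ w → deg v (red cs) ≡ 0)
red-loops w zero    []       = (0 , refl) , λ _ _ → refl
red-loops w (suc k) (false ∷ cs) = red-loops w k cs
red-loops w (suc k) (true ∷ cs) with red-loops w k cs
... | (j , p) , none = (suc j , trans (cong₂ _+_ (inc-loop w) p) (cong suc (≡-sym (+-suc j j)))) ,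
      λ v v≢w → cong₂ _+_ (inc-≢ {v = v} {w} {w} (v≢w ∘ ≡-sym) (v≢w ∘ ≡-sym)) (none v v≢w)

-- By parity `b` is odd, hence 1 or 3; `k` is the number of loops that restores degree 5 at the
-- contracted vertex.
oddBoundary : ∀ b c h → b ≤ 4 → b + (c + c) ≡ 5 * suc (h + h) → ∃ λ k → b + (k + k) ≡ 5
oddBoundary b c h b≤4 eq = go b b≤4 (trans eq (solve 1 (λ h → con 5 :* (con 1 :+ (h :+ h)) :=
    con 1 :+ ((con 2 :+ con 5 :* h) :+ (con 2 :+ con 5 :* h))) refl h))
  where
  go : ∀ b → b ≤ 4 → b + (c + c) ≡ suc ((2 + 5 * h) + (2 + 5 * h)) → ∃ λ k → b + (k + k) ≡ 5
  go 0 _ q = ⊥-elim (double≢odd c (2 + 5 * h) q)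
  go 1 _ _ = 2 , refl
  go 2 _ q = ⊥-elim (double≢odd (suc c) (2 + 5 * h) (trans (cong suc (+-suc c c)) q))
  go 3 _ _ = 1 , refl
  go 4 _ q = ⊥-elim (double≢odd (2 + c) (2 + 5 * h) (trans (solve 1 (λ c → (con 2 :+ c) :+ (con 2 :+ c) := con 4 :+ (c :+ c)) refl c) q))
  go (suc (suc (suc (suc (suc _))))) (s≤s (s≤s (s≤s (s≤s ())))) _

-- Exchanging the colours turns red degree 4 into red degree 1.
normalise : ∀ {n} {A : Fin n → Bool} {H : List (Edge n)} → RegularOn 5 A H → ∀ w → A w ≡ true → FactorOn A H →
            Σ (FactorOn A H) λ f → deg w (red (proj₁ f)) ≡ 1
normalise {A = A} (regular , _) w Aw (cs , legal) with legal w Aw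
... | inj₂ one  = (cs , legal) , one
... | inj₁ four = (opposite cs , λ v Av → flip (legal v Av) (sum5 v Av)) ,
    +-cancelˡ-≡ 4 _ _ (trans (cong (_+ deg w (red (opposite cs))) (≡-sym four)) (sum5 w Aw))
  where
  sum5 : ∀ v → A v ≡ true → deg v (red cs) + deg v (red (opposite cs)) ≡ 5
  sum5 v Av = trans (W-opposite (inc v) cs) (regular v Av)
  flip : ∀ {x y} → Legal x → x + y ≡ 5 → Legal y
  flip (inj₁ refl) p = inj₂ (+-cancelˡ-≡ 4 _ _ p)
  flip (inj₂ refl) p = inj₁ (+-cancelˡ-≡ 1 _ _ p)

-- Contracting a vertex set to one of its vertices

module Contract {n : ℕ} (D : Fin n → Bool) (w : Fin n) (Dw : D w ≡ true) where

  contract : Fin n → Fin n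
  contract v = if D v then w else v

  contract-w : ∀ a → δ (contract a) w ≡ bit (D a)
  contract-w a with D a in Da
  ... | true  = δ-refl w
  ... | false = δ-≢ {a = a} {w} λ { refl → false≢true (trans (≡-sym Da) Dw) }

  contract-out : ∀ {v} → D v ≡ false → ∀ a → δ (contract a) v ≡ δ a v
  contract-out {v} Dv a with D a in Da
  ... | true  = trans (δ-≢ {a = w} {v} λ { refl → false≢true (trans (≡-sym Dv) Dw) })
                      (≡-sym (δ-≢ {a = a} {v} λ { refl → false≢true (trans (≡-sym Dv) Da) }))
  ... | false = refl

  contract-gone : ∀ {v} → D v ≡ true → v ≢ w → ∀ a → δ (contract a) v ≡ 0
  contract-gone {v} Dv v≢w a with D a in Da
  ... | true  = δ-≢ (v≢w ∘ ≡-sym)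
  ... | false = δ-≢ {a = a} {v} λ { refl → false≢true (trans (≡-sym Da) Dv) }

  deg-contract-w : ∀ L → deg w (mapᴱ contract L) ≡ W (λ (a , b) → bit (D a) + bit (D b)) L
  deg-contract-w L = trans (W-map (inc w) contract L) (W-cong L λ (a , b) → cong₂ _+_ (contract-w a) (contract-w b))

  deg-contract-out : ∀ {v} → D v ≡ false → ∀ L → deg v (mapᴱ contract L) ≡ deg v L
  deg-contract-out {v} Dv L = trans (W-map (inc v) contract L)
    (W-cong L λ (a , b) → cong₂ _+_ (contract-out Dv a) (contract-out Dv b))

  deg-contract-gone : ∀ {v} → D v ≡ true → v ≢ w → ∀ L → deg v (mapᴱ contract L) ≡ 0
  deg-contract-gone {v} Dv v≢w [] = refl
  deg-contract-gone {v} Dv v≢w ((a , b) ∷ L) =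
    cong₂ _+_ (cong₂ _+_ (contract-gone Dv v≢w a) (contract-gone Dv v≢w b)) (deg-contract-gone Dv v≢w L)

  -- Red loops contribute an even number at `w`, so red degree 1 there comes from the images of the
  -- edges in `X`: exactly one red half-edge of `X` ends in `D`.
  uncontract : ∀ k X A → (∀ v → D v ≡ false → A v ≡ true) →
    (Σ (FactorOn A (replicate k (w , w) ++ mapᴱ contract X)) λ f → deg w (red (proj₁ f)) ≡ 1) →
    Σ (Colouring X) λ xs → (∀ v → D v ≡ false → Legal (deg v (red xs))) ×
      Σ-fin (λ v → bit (D v) * deg v (red xs)) ≡ 1
  uncontract k X A outside ((cs , legal) , one) with splitᶜ (replicate k (w , w)) cs
  ... | ls , ms , refl = xs , out ,
        trans (handshake (bit ∘ D) (red xs)) (trans (≡-sym (deg-contract-w (red xs))) (trans (≡-sym (deg-ms w)) one-ms))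
    where
    xs : Colouring X
    xs = unmapᶜ contract ms
    deg-ms : ∀ v → deg v (red ms) ≡ deg v (mapᴱ contract (red xs))
    deg-ms v = cong (deg v) (red-unmapᶜ contract ms)
    onLoops = red-loops w k ls
    one-ms : deg w (red ms) ≡ 1
    one-ms = go (proj₁ (proj₁ onLoops))
      (trans (≡-sym (trans (W-red-++ (inc w) ls ms) (cong (_+ deg w (red ms)) (proj₂ (proj₁ onLoops))))) one)
      where
      go : ∀ j {m} → j + j + m ≡ 1 → m ≡ 1
      go zero p = p
      go (suc j) p rewrite +-suc j j with () ← p
    out : ∀ v → D v ≡ false → Legal (deg v (red xs))
    out v Dv = subst Legal
      (trans (W-red-++ (inc v) ls ms) (cong₂ _+_ (proj₂ onLoops v λ { refl → false≢true (trans (≡-sym Dv) Dw) })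
        (trans (deg-ms v) (deg-contract-out Dv (red xs))))) (legal v (outside v Dv))

uniqueExit : ∀ {n} (D : Fin n → Bool) (d : Fin n → ℕ) → Σ-fin (λ v → bit (D v) * d v) ≡ 1 →
             ∃ λ x → D x ≡ true × d x ≡ 1 × (∀ v → D v ≡ true → v ≢ x → d v ≡ 0)
uniqueExit D d h with Σ-unique (λ v → bit (D v) * d v) h
... | x , fx , others = x , proj₁ at-x , proj₂ at-x , λ v Dv v≢x →
      trans (≡-sym (+-identityʳ (d v))) (trans (cong (λ b → bit b * d v) (≡-sym Dv)) (others v v≢x))
  where
  at-x : D x ≡ true × d x ≡ 1
  at-x with D x
  ... | true = refl , trans (≡-sym (+-identityʳ (d x))) fx

module Cuts {N : ℕ} (E : List (Edge N)) (regular : ∀ v → deg v E ≡ 5) (minimal : Minimal N)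
            (noFactor : ¬ FactorOn (λ _ → true) E) where

  boundary loops : (Fin N → Bool) → ℕ
  boundary D = W (cross D) E
  loops D = W (loopIn D) E

  weigh : ∀ (t : Fin N → ℕ) → W (λ (a , b) → t a + t b) E ≡ 5 * Σ-fin t
  weigh t = trans (≡-sym (handshake t E)) (trans (Σ-cong λ v → trans (cong (t v *_) (regular v)) (*-comm (t v) 5)) (Σ-*ˡ 5 t))

  boundary-within : ∀ D → boundary D + (W (within D) E + W (within D) E) ≡ 5 * count D
  boundary-within D = trans (≡-sym (trans (W-cong E (cross-within D)) (trans (W-+ (cross D) _ E)
    (cong (boundary D +_) (W-+ (within D) (within D) E))))) (weigh (bit ∘ D))

  module Step (D : Fin N → Bool) (h : ℕ) (odd : count D ≡ suc (h + h))
              (light : boundary D + (loops D + loops D) ≤ 4)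
              (IH : ∀ D′ → count D′ < count D → (∃ λ h → count D′ ≡ suc (h + h)) →
                    5 ≤ boundary D′ + (loops D′ + loops D′)) where

    abstract
      nonempty : ∃ λ w → bit (D w) ≢ 0
      nonempty = Σ-positive (bit ∘ D) λ p → 0≢1+n (trans (≡-sym p) odd)

    w : Fin N
    w = proj₁ nonempty

    Dw : D w ≡ true
    Dw = bit-true (n≢0⇒n>0 (proj₂ nonempty))

    open Contract D w Dw

    -- Contraction has to lose a vertex. If `D` were only `w`, all edges within `D` would be loops
    -- and |∂D| + 2·loops(D) would be at least 5, contrary to `light`.
    second : ∃ λ y → D y ≡ true × y ≢ w
    second with Finₚ.any? (λ y → (D y Boolₚ.≟ true) ×-dec ¬? (y Fin.≟ w))
    ... | yes p = p
    ... | no none = ⊥-elim (<⇒≱ (s≤s light) (begin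
        5                                                   ≤⟨ m≤m*n 5 (suc (h + h)) ⟩
        5 * suc (h + h)                                     ≡⟨ cong (5 *_) (≡-sym odd) ⟩
        5 * count D                                         ≡⟨ ≡-sym (boundary-within D) ⟩
        boundary D + (W (within D) E + W (within D) E)      ≤⟨ +-monoʳ-≤ (boundary D) (+-mono-≤ (W-mono E le) (W-mono E le)) ⟩
        boundary D + (loops D + loops D) ∎))
      where
      open ≤-Reasoning
      only : ∀ {y} → D y ≡ true → y ≡ w
      only {y} Dy with y Fin.≟ w
      ... | yes p = p
      ... | no p  = contradiction (y , Dy , p) none
      le : ∀ e → within D e ≤ loopIn D e
      le (a , b) with D a in Da | D b in Db
      ... | false | _     = z≤n
      ... | true  | false = z≤n
      ... | true  | true rewrite only Da | only Db | δ-refl w = ≤-refl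

    abstract
      parts : Partition D E
      parts = partition D E

    I = proj₁ parts
    X = proj₁ (proj₂ parts)
    E≈ : E ≈ I ++ X
    E≈ = proj₁ (proj₂ (proj₂ parts))
    inside : All (λ (a , b) → D a ≡ true × D b ≡ true) I
    inside = proj₁ (proj₂ (proj₂ (proj₂ parts)))
    notInside : All (λ (a , b) → D a ∧ D b ≡ false) X
    notInside = proj₂ (proj₂ (proj₂ (proj₂ parts)))

    W-parts : ∀ {f : Edge N → ℕ} → Symm f → W f E ≡ W f I + W f X
    W-parts {f} s = trans (W-≈ s E≈) (W-++ f I X)

    deg-I-out : ∀ {v} → D v ≡ false → deg v I ≡ 0
    deg-I-out {v} Dv = go inside
      where
      go : ∀ {L} → All (λ (a , b) → D a ≡ true × D b ≡ true) L → deg v L ≡ 0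
      go [] = refl
      go {(a , b) ∷ _} ((Da , Db) ∷ ps) = cong₂ _+_ (inc-≢ {v = v} {a} {b} (λ { refl → false≢true (trans (≡-sym Dv) Da) })
                                             (λ { refl → false≢true (trans (≡-sym Dv) Db) })) (go ps)

    boundary-I : W (cross D) I ≡ 0
    boundary-I = go inside
      where
      go : ∀ {L} → All (λ (a , b) → D a ≡ true × D b ≡ true) L → W (cross D) L ≡ 0
      go [] = refl
      go ((Da , Db) ∷ ps) = cong₂ _+_ (cong bit (cong₂ _xor_ Da Db)) (go ps)

    boundary-X : boundary D ≡ W (cross D) X
    boundary-X = trans (W-parts (cross-flip D)) (cong (_+ W (cross D) X) boundary-I)

    crossX : ∀ a b → D a ∧ D b ≡ false → bit (D a) + bit (D b) ≡ cross D (a , b)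
    crossX a b p with D a | D b
    ... | true  | false = refl
    ... | false | true  = refl
    ... | false | false = refl

    -- Contract D to w, with enough loops to restore the degree 5.
    abstract
      someK : ∃ λ k → boundary D + (k + k) ≡ 5
      someK = oddBoundary (boundary D) (W (within D) E) h (≤-trans (m≤m+n _ _) light) (trans (boundary-within D) (cong (5 *_) odd))

    k : ℕ
    k = proj₁ someK

    H : List (Edge N)
    H = replicate k (w , w) ++ mapᴱ contract X

    deg-H : ∀ v → deg v H ≡ k * inc v (w , w) + deg v (mapᴱ contract X)
    deg-H v = trans (W-++ (inc v) (replicate k (w , w)) _) (cong (_+ deg v (mapᴱ contract X)) (W-replicate (inc v) k (w , w)))

    alive? : ∀ v → Dec (D v ≡ false ⊎ v ≡ w)
    alive? v = (D v Boolₚ.≟ false) ⊎-dec (v Fin.≟ w)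

    A : Fin N → Bool
    A v = does (alive? v)

    regular-H : RegularOn 5 A H
    regular-H = (λ v Av → [ out v , (λ { refl → at-w }) ]′ (does⇒ (alive? v) Av)) , dead
      where
      at-w : deg w H ≡ 5
      at-w = begin
        deg w H                                        ≡⟨ deg-H w ⟩
        k * inc w (w , w) + deg w (mapᴱ contract X)    ≡⟨ cong₂ _+_ (cong (k *_) (inc-loop w)) (deg-contract-w X) ⟩
        k * 2 + W (λ (a , b) → bit (D a) + bit (D b)) X
          ≡⟨ cong₂ _+_ (solve 1 (λ k → k :* con 2 := k :+ k) refl k)
               (trans (W-congᴬ (All.map (λ {e} → crossX (proj₁ e) (proj₂ e)) notInside)) (≡-sym boundary-X)) ⟩
        (k + k) + boundary D                           ≡⟨ +-comm (k + k) _ ⟩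
        boundary D + (k + k)                           ≡⟨ proj₂ someK ⟩
        5 ∎
        where open ≡-Reasoning
      noLoop : ∀ {v} → v ≢ w → k * inc v (w , w) ≡ 0
      noLoop {v} v≢w = trans (cong (k *_) (inc-≢ {v = v} {w} {w} (v≢w ∘ ≡-sym) (v≢w ∘ ≡-sym))) (*-zeroʳ k)
      out : ∀ v → D v ≡ false → deg v H ≡ 5
      out v Dv = trans (deg-H v) (trans (cong₂ _+_ (noLoop {v} λ { refl → false≢true (trans (≡-sym Dv) Dw) }) (deg-contract-out Dv X))
        (trans (cong (_+ deg v X) (≡-sym (deg-I-out Dv))) (trans (≡-sym (W-parts (inc-flip v))) (regular v))))
      dead : ∀ v → A v ≡ false → deg v H ≡ 0
      dead v Av = trans (deg-H v) (cong₂ _+_ (noLoop v≢w) (deg-contract-gone Dv v≢w X))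
        where
        ¬alive : ¬ (D v ≡ false ⊎ v ≡ w)
        ¬alive p = false≢true (trans (≡-sym Av) (dec-true (alive? v) p))
        v≢w = ¬alive ∘ inj₂
        Dv = Boolₚ.¬-not (¬alive ∘ inj₁)

    small : count A < N
    small = let y , Dy , y≢w = second in
      count< A y (dec-false (alive? y) [ (λ p → false≢true (trans (≡-sym p) Dy)) , y≢w ]′)

    abstract
      crossColouring : Σ (Colouring X) λ xs → (∀ v → D v ≡ false → Legal (deg v (red xs))) ×
                       Σ-fin (λ v → bit (D v) * deg v (red xs)) ≡ 1
      crossColouring = uncontract k X A (λ v Dv → dec-true (alive? v) (inj₁ Dv))
        (normalise regular-H w (dec-true (alive? w) (inj₂ refl)) (factorOnSmaller minimal A small H regular-H))

    xs : Colouring X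
    xs = proj₁ crossColouring

    abstract
      exit : ∃ λ x → D x ≡ true × deg x (red xs) ≡ 1 × (∀ v → D v ≡ true → v ≢ x → deg v (red xs) ≡ 0)
      exit = uniqueExit D (λ v → deg v (red xs)) (proj₂ (proj₂ crossColouring))

    x : Fin N
    x = proj₁ exit

    Dx : D x ≡ true
    Dx = proj₁ (proj₂ exit)

    D₋ : Fin N → Bool
    D₋ = without D x

    -- The exit edge gives `x` red degree 1, and the matching gives it to the other vertices of `D`,
    -- which `xs` leaves without red edges. Outside `D` the red degrees are those of the contracted
    -- graph.
    notPerfect : ¬ Perfect I D₋
    notPerfect pm with perfectColouring pm
    ... | is , d with recolour (≈-sym E≈) (is ++ᶜ xs)
    ...   | cs , p = noFactor (cs , λ v _ → subst Legal (≡-sym (at v)) (legal v))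
      where
      at : ∀ v → deg v (red cs) ≡ bit (D₋ v) + deg v (red xs)
      at v = trans (≡-sym (deg-≈ v p)) (trans (W-red-++ (inc v) is xs) (cong (_+ deg v (red xs)) (d v)))
      legal : ∀ v → Legal (bit (D₋ v) + deg v (red xs))
      legal v with v Fin.≟ x
      ... | yes refl rewrite without-≡ D x = inj₂ (proj₁ (proj₂ (proj₂ exit)))
      ... | no v≢x rewrite without-≢ D (v≢x ∘ ≡-sym) with D v in Dv
      ...   | true  = inj₂ (cong suc (proj₂ (proj₂ (proj₂ exit)) v Dv v≢x))
      ...   | false = proj₁ (proj₂ crossColouring) v Dv

    noBarrier : (B : Barrier I D₋) → 2 + count (Barrier.S B) ≤ count (Barrier.R B) → ⊥
    noBarrier B big with pull-deg x X (≤-trans (≤-reflexive (≡-sym (proj₁ (proj₂ (proj₂ exit))))) (W-red-≤ (inc x) xs))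
    ... | y , X′ , X≈ = <⇒≱ (s≤s light) (≤-trans (m≤n+m 5 2) total)
      where
      open Barrier B
      open BarrierCount B
      notInside′ : All (λ (a , b) → D a ∧ D b ≡ false) ((x , y) ∷ X′)
      notInside′ = All-≈ (λ a b p → trans (Boolₚ.∧-comm (D b) (D a)) p) X≈ notInside
      Dy : D y ≡ false
      Dy = trans (cong (_∧ D y) (≡-sym Dx)) (All.head notInside′)
      W-E : ∀ {f : Edge N → ℕ} → Symm f → W f E ≡ W f I + (f (x , y) + W f X′)
      W-E {f} s = trans (W-parts s) (cong (W f I +_) (W-≈ s X≈))
      -- `x` is charged like a vertex of the Tutte set: it lies outside `D₋`, so edges inside `D`
      -- can leave a piece towards `x` as well.
      t : Fin N → ℕ
      t v = bit (S v) + δ x v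
      tt : Edge N → ℕ
      tt (a , b) = t a + t b
      D₋-out : ∀ {v} → D v ≡ false → D₋ v ≡ false
      D₋-out {v} Dv = Boolₚ.¬-not λ p → false≢true (trans (≡-sym Dv) (proj₁ (without-⊆ D x p)))
      blocked≤ : ∀ {v} → D v ≡ true → bit (blocked v) ≤ t v
      blocked≤ {v} Dv = go (x Fin.≟ v)
        where
        go : Dec (x ≡ v) → bit (blocked v) ≤ t v
        go (yes refl) = ≤-trans (bit≤1 (blocked x)) (≤-trans (≤-reflexive (≡-sym (δ-refl x))) (m≤n+m _ (bit (S x))))
        go (no x≢v) rewrite trans (without-≢ D x≢v) Dv | Boolₚ.∨-identityʳ (S v) = m≤m+n _ _
      onI : W crossings I ≤ W tt I
      onI = W-monoᴬ (All.zipWith (λ { {a , b} (ab , Da , Db) → ≤-trans (crossings≤blocked a b ab) (+-mono-≤ (blocked≤ Da) (blocked≤ Db)) })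
                      (selfAdj I , inside))
      classes≤D : ∀ a → classes a ≤ bit (D a)
      classes≤D a with D a in Da
      ... | true  = classes≤1 a
      ... | false = ≤-reflexive (outside (inj₁ (D₋-out Da)))
      onX : W crossings X′ ≤ W (cross D) X′
      onX = W-monoᴬ (All.map (λ { {a , b} p → ≤-trans (crossings≤classes a b)
              (≤-trans (+-mono-≤ (classes≤D a) (classes≤D b)) (≤-reflexive (crossX a b p))) }) (All.tail notInside′))
      on-xy : crossings (x , y) ≡ 0
      on-xy = n≤0⇒n≡0 (≤-trans (crossings≤classes x y)
                (≤-reflexive (cong₂ _+_ (outside (inj₁ (without-≡ D x))) (outside (inj₁ (D₋-out Dy))))))
      Σt : Σ-fin t ≡ count S + 1
      Σt = trans (Σ-+ (bit ∘ S) (δ x)) (cong (count S +_) (Σ-δ₁ x))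
      tt≥1 : 1 ≤ tt (x , y)
      tt≥1 = ≤-trans (≤-reflexive (≡-sym (δ-refl x))) (≤-trans (m≤n+m _ (bit (S x))) (m≤m+n _ (t y)))
      -- The 2 is gained at the boundary edge `xy`. Neither end lies in a piece, so it is never a
      -- crossing, yet the right side counts it twice: at `x` through `tt`, and in `cross D`.
      budget : W crossings E + 2 ≤ 5 * (count S + 1) + boundary D
      budget = begin
        W crossings E + 2                                         ≡⟨ cong (_+ 2) (W-E crossings-flip) ⟩
        W crossings I + (crossings (x , y) + W crossings X′) + 2  ≡⟨ cong (λ c → W crossings I + (c + W crossings X′) + 2) on-xy ⟩
        W crossings I + W crossings X′ + 2                        ≤⟨ +-monoˡ-≤ 2 (+-mono-≤ onI onX) ⟩
        W tt I + W (cross D) X′ + 2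
          ≡⟨ solve 2 (λ p q → p :+ q :+ con 2 := p :+ con 1 :+ (con 1 :+ q)) refl (W tt I) (W (cross D) X′) ⟩
        W tt I + 1 + (1 + W (cross D) X′)
          ≤⟨ +-mono-≤ (+-monoʳ-≤ (W tt I) (≤-trans tt≥1 (m≤m+n _ (W tt X′))))
                      (≤-reflexive (cong (λ c → c + W (cross D) X′) (≡-sym (cong bit (cong₂ _xor_ Dx Dy))))) ⟩
        W tt I + (tt (x , y) + W tt X′) + (cross D (x , y) + W (cross D) X′)
          ≡⟨ cong₂ _+_ (trans (≡-sym (W-E (λ a b → +-comm (t a) (t b)))) (trans (weigh t) (cong (5 *_) Σt)))
                       (≡-sym (trans boundary-X (W-≈ (cross-flip D) X≈))) ⟩
        5 * (count S + 1) + boundary D ∎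
        where open ≤-Reasoning
      smaller : ∀ {r} → R r ≡ true → count (C r) < count D
      smaller {r} Rr = subst (count (C r) <_) (≡-sym (count-without D x Dx)) (s≤s (Σ-mono sub))
        where
        sub : ∀ v → bit (C r v) ≤ bit (D₋ v)
        sub v with C r v in c
        ... | false = z≤n
        ... | true  = ≤-reflexive (cong bit (≡-sym (C⊆A Rr c)))
      loops₋ : W (loopIn D₋) E ≤ loops D
      loops₋ = W-mono E λ (a , b) → *-monoˡ-≤ (δ a b) (sub a)
        where
        sub : ∀ v → bit (D₋ v) ≤ bit (D v)
        sub v with D₋ v in c
        ... | false = z≤n
        ... | true  = ≤-reflexive (cong bit (≡-sym (proj₁ (without-⊆ D x c))))
      -- Comparing 5(s + 2) + 2 with 5(s + 1) + |∂D| + 2·loops(D) leaves 7.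
      total : 7 ≤ boundary D + (loops D + loops D)
      total = +-cancelˡ-≤ (5 * count S + 5) _ _ (begin
        5 * count S + 5 + 7
          ≡⟨ solve 1 (λ s → con 5 :* s :+ con 5 :+ con 7 := con 5 :* (con 2 :+ s) :+ con 2) refl (count S) ⟩
        5 * (2 + count S) + 2
          ≤⟨ +-monoˡ-≤ 2 (≤-trans (*-monoʳ-≤ 5 big) (charge E (λ {r} Rr → IH (C r) (smaller Rr) (C-odd Rr)))) ⟩
        W crossings E + (W (loopIn D₋) E + W (loopIn D₋) E) + 2
          ≤⟨ +-monoˡ-≤ 2 (+-monoʳ-≤ (W crossings E) (+-mono-≤ loops₋ loops₋)) ⟩
        W crossings E + (loops D + loops D) + 2
          ≡⟨ solve 2 (λ c l → c :+ l :+ con 2 := (c :+ con 2) :+ l) refl (W crossings E) (loops D + loops D) ⟩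
        W crossings E + 2 + (loops D + loops D)
          ≤⟨ +-monoˡ-≤ (loops D + loops D) budget ⟩
        5 * (count S + 1) + boundary D + (loops D + loops D)
          ≡⟨ solve 3 (λ s b l → con 5 :* (s :+ con 1) :+ b :+ l := con 5 :* s :+ con 5 :+ (b :+ l)) refl (count S) (boundary D) (loops D + loops D) ⟩
        5 * count S + 5 + (boundary D + (loops D + loops D)) ∎)
        where open ≤-Reasoning

    impossible : ⊥
    impossible = tutte I D₋ h (suc-injective (trans (≡-sym (count-without D x Dx)) odd)) notPerfect
      λ (B , big) → noBarrier B big

  oddCut : ∀ k D → count D ≤ k → (∃ λ h → count D ≡ suc (h + h)) → 5 ≤ boundary D + (loops D + loops D)
  oddCut zero D le (h , odd) with () ← subst (_≤ 0) odd le
  oddCut (suc k) D le (h , odd) with 5 ≤? boundary D + (loops D + loops D)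
  ... | yes p = p
  ... | no p  = ⊥-elim (Step.impossible D h odd (s≤s⁻¹ (≰⇒> p))
                  λ D′ lt → oddCut k D′ (s≤s⁻¹ (≤-trans lt le)))

  -- At least five loops

  manyLoops : 5 ≤ W (λ (a , b) → δ a b) E
  manyLoops with 5 ≤? W (λ (a , b) → δ a b) E
  ... | yes p = p
  ... | no few = ⊥-elim (tutte E everything (proj₁ even) (proj₂ even) notPerfect λ (B , big) → noBarrier B big)
    where
    everything : Fin N → Bool
    everything _ = true
    -- A 5-regular graph has an even number of vertices, because 5N is twice the number of edges.
    even : ∃ λ h → count everything ≡ h + h
    even with evenOrOdd (count everything)
    ... | inj₁ p = p
    ... | inj₂ (h , p) = ⊥-elim (double≢odd (W (within everything) E) (2 + 5 * h) (trans
        (trans (cong (_+ (W (within everything) E + W (within everything) E)) (≡-sym noBoundary)) (boundary-within everything))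
        (trans (cong (5 *_) p) (solve 1 (λ h → con 5 :* (con 1 :+ (h :+ h)) :=
           con 1 :+ ((con 2 :+ con 5 :* h) :+ (con 2 :+ con 5 :* h))) refl h))))
      where
      noBoundary : boundary everything ≡ 0
      noBoundary = W-0 E
    notPerfect : ¬ Perfect E everything
    notPerfect pm with perfectColouring pm
    ... | cs , d = noFactor (cs , λ v _ → inj₂ (d v))
    -- With all vertices present only edges at the Tutte set can leave a piece: 5(s + 2) ≤ 5s + 2L
    -- forces L ≥ 5.
    noBarrier : (B : Barrier E everything) → 2 + count (Barrier.S B) ≤ count (Barrier.R B) → ⊥
    noBarrier B big = few (half (+-cancelˡ-≤ (5 * count S) _ _ (begin
      5 * count S + 10               ≡⟨ solve 1 (λ s → con 5 :* s :+ con 10 := con 5 :* (con 2 :+ s)) refl (count S) ⟩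
      5 * (2 + count S)              ≤⟨ *-monoʳ-≤ 5 big ⟩
      5 * count R                    ≤⟨ charge E (λ {r} Rr → oddCut (count (C r)) (C r) ≤-refl (C-odd Rr)) ⟩
      W crossings E + (L₁ + L₁)      ≤⟨ +-mono-≤ onE (≤-reflexive (cong₂ _+_ L₁≡ L₁≡)) ⟩
      5 * count S + (L + L) ∎)))
      where
      open ≤-Reasoning
      open Barrier B
      open BarrierCount B
      L₁ = W (loopIn everything) E
      L = W (λ (a , b) → δ a b) E
      L₁≡ : L₁ ≡ L
      L₁≡ = W-cong E λ (a , b) → +-identityʳ (δ a b)
      half : ∀ {l} → 10 ≤ l + l → 5 ≤ l
      half {l} q = ≮⇒≥ λ l<5 → <⇒≱ (s≤s (+-mono-≤ (s≤s⁻¹ l<5) (s≤s⁻¹ l<5))) (≤-trans (n≤1+n 9) q)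
      onE : W crossings E ≤ 5 * count S
      onE = ≤-trans (W-monoᴬ (All.map (λ { {a , b} ab → ≤-trans (crossings≤blocked a b ab)
              (≤-reflexive (cong₂ _+_ (cong bit (Boolₚ.∨-identityʳ (S a))) (cong bit (Boolₚ.∨-identityʳ (S b))))) }) (selfAdj E)))
            (≤-reflexive (weigh (bit ∘ S)))

-- Back to multiplicity matrices

loopCount-mul : ∀ {n} (E : List (Edge n)) → Σ-fin (λ v → W (mul v v) E) ≡ W (λ (a , b) → δ a b) E
loopCount-mul E = begin
  Σ-fin (λ v → W (mul v v) E)               ≡⟨ Σ-cong (λ v → ≡-sym (+-identityʳ (W (mul v v) E))) ⟩
  Σ-fin (λ v → 1 * W (mul v v) E)           ≡⟨ Σ-W (λ _ → 1) (λ v → mul v v) E ⟩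
  W (λ e → Σ-fin (λ v → 1 * mul v v e)) E   ≡⟨ W-cong E (λ e → trans (Σ-cong (λ v → +-identityʳ (mul v v e))) (diagonal e)) ⟩
  W (λ (a , b) → δ a b) E ∎
  where
  open ≡-Reasoning
  diagonal : ∀ e → Σ-fin (λ v → mul v v e) ≡ δ (proj₁ e) (proj₂ e)
  diagonal (x , y) = trans (Σ-+ (λ v → δ x v * δ y v) (λ v → (1 ∸ δ x y) * (δ x v * δ y v)))
    (trans (cong₂ _+_ (Σ-δ x (δ y)) (trans (Σ-*ˡ (1 ∸ δ x y) (λ v → δ x v * δ y v)) (cong ((1 ∸ δ x y) *_) (Σ-δ x (δ y)))))
      (go (x Fin.≟ y)))
    where
    go : Dec (x ≡ y) → δ y x + (1 ∸ δ x y) * δ y x ≡ δ x y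
    go (yes refl) rewrite δ-refl x = refl
    go (no x≢y) rewrite δ-≢ x≢y | δ-≢ (x≢y ∘ ≡-sym) = refl

theorem8 : (G : Graph) → Regular 5 G → ¬ Factor41 G →
  ((H : Graph) → Regular 5 H → n H < n G → Factor41 H) →
  (¬ ContainsK4 G)
  × (∀ u v → u ≢ v → adj G u v ≤ 1)
  × (∀ u v → HasLoop G u → HasLoop G v → ¬ Adjacent G u v)
  × (5 ≤ loopCount G)
  × ¬ (Σ (Fin 3 → Fin (n G)) λ us → Σ (Fin 3 → Fin (n G)) λ vs →
        Injective _≡_ _≡_ us × Injective _≡_ _≡_ vs × (∀ i j → us i ≢ vs j)
        × (∀ i → HasLoop G (us i)) × (∀ i j → Adjacent G (us i) (vs j)))
theorem8 G regular noFactor minimal with edgesOf (adj G) (sym G)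
... | E , mul≡adj =
    (λ (f , inj , K4) → noK4 f inj λ a b a≢b → inE (K4 a b a≢b))
  , (λ u v u≢v → ≮⇒≥ λ many → noParallel u≢v (inE many))
  , (λ u v hu hv (u≢v , uv) → noAdjacentLoops u≢v (inE hu) (inE hv) (inE uv))
  , subst (5 ≤_) (≡-sym (trans (Σ-cong (λ v → ≡-sym (mul≡adj v v))) (loopCount-mul E))) manyLoops
  , (λ (us , vs , us-inj , vs-inj , us≢vs , loop , adjacent) →
      noK33 us vs us-inj vs-inj us≢vs (λ i → inE (loop i)) λ i j → inE (proj₂ (adjacent i j)))
  where
  inE : ∀ {k a b} → k ≤ adj G a b → k ≤ W (mul a b) E
  inE {k} {a} {b} = subst (k ≤_) (≡-sym (mul≡adj a b))
  regularE : ∀ v → deg v E ≡ 5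
  regularE v = trans (≡-sym (degreeOf-mul E v)) (trans (degreeOf-cong mul≡adj v) (regular v))
  noFactorE : ¬ FactorOn (λ _ → true) E
  noFactorE f = noFactor (factorFrom G E mul≡adj f)
  open Reducible E regularE minimal noFactorE
  open Cuts E regularE minimal noFactorE
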